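{- Let $R$ be an odd rectangle, and let $A$ and $B$ be minimum+1 configurations with span $R$. Suppose $A\neq B$ and that $B$ cannot be obtained from $A$ by a single move. Then $A\to B$ if and only if there exist a move $c_1\mapsto p_1$ from $A$, resulting in a configuration $A_1$, and coins $a\in A_1$, $b\in B$ such that: $a$ is a neighbor of $p_1$; $b$ is a redundant coin in $B$; and $A_1\setminus\{a\}\xrightarrow{\mathcal{P}}B\setminus\{b\}$. As a consequence, deciding whether $A\to B$, when $A$ and $B$ are minimum+1 configurations whose span is the same odd rectangle, reduces to the poking game up to a factor $O(N^2)$, where $N:=|A|=|B|$ (i.e. it reduces to deciding $O(N^2)$ instances of the poking game).
   Context: The board is the square grid: positions are the elements of $\mathbb{Z}^2$, each position having four neighbors (left, right, top, bottom). A configuration is a finite subset $C\subset\mathbb{Z}^2$; its elements are called coins. A (legal) move $c\mapsto p$ from a configuration $A$ takes $c\in A$ and $p\notin A$ such that $p$ has at least two neighbors in $A\setminus\{c\}$, and produces $(A\setminus\{c\})\cup\{p\}$. We write $A\to B$ if $B$ can be obtained from $A$ by a finite (possibly empty) sequence of moves. The span of a configuration $C$, $\mathrm{span}(C)$, is the limit of the (eventually constant) sequence $C_0=C$, $C_{i+1}=C_i\cup\{p\notin C_i : p \text{ has at least two neighbors in } C_i\}$. An $m\times n$ rectangle is a set $I\times J$ with $I,J$ intervals of integers of cardinality $m$ and $n$; it is odd if $m+n$ is odd. A configuration $M$ is minimum if no configuration with the same span has fewer coins. If the span of a minimum configuration is an odd rectangle, the configuration contains at most one pair of adjacent coins. A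 configuration $A$ is minimum+1 if $A=M\cup\{a\}$ where $M$ is a minimum configuration with the same span as $A$ and $a\notin M$. A coin $b\in B$ is redundant in $B$ if it has at least two neighbors in $B$. Poking game: let $M$ be a minimum configuration with span $R$ containing a pair $\{c_1,c_2\}$ of adjacent coins. A poke $c_i\xmapsto{\mathcal{P}}p$ from $M$ (for some $i\in\{1,2\}$) consists in replacing $c_i$ by one of its free neighboring positions $p\notin M$ such that $p$ has at least one neighboring coin in $M$ other than $c_i$; the result is $(M\setminus\{c_i\})\cup\{p\}$, which is again a minimum configuration with span $R$ containing a pair of adjacent coins. The relation $M\xrightarrow{\mathcal{P}}M'$ is defined for minimum configurations $M,M'$ with the same span $R$ each containing a pair of adjacent coins (so asserting it includes asserting that $M,M'$ are such), and means that $M'$ is obtained from $M$ by a finite (possibly empty) sequence of pokes. An instance of the poking game asks, given two such configurations $M,M'$, whether $M\xrightarrow{\mathcal{P}}M'$. -}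

module Defs where

open import Level using (0ℓ)
open import Data.Integer.Base as ℤ using (ℤ; +_)
import Data.Integer.Properties as ℤ
open import Data.List.Base using (List; []; _∷_; length; filter)
open import Data.List.Membership.Propositional using () renaming (_∈_ to _∈ˡ_)
open import Data.List.Relation.Unary.All using (All)
open import Data.List.Relation.Unary.Any using (Any)
open import Data.List.Relation.Unary.Unique.Propositional using (Unique)
open import Data.List.Relation.Unary.Unique.Propositional.Properties using (filter⁺)
open import Data.Nat.Base as ℕ using (ℕ; zero; suc; parity)
open import Data.Parity.Base using (1ℙ)
open import Data.Product.Base using (∃; ∃₂; ∃-syntax; _×_; _,_)
open import Data.Product.Properties using (≡-dec)
open import Data.Sum.Base using (_⊎_)
open import Function.Bundles using (_⇔_)
open import Relation.Binary.Construct.Closure.ReflexiveTransitive using (Star)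
open import Relation.Binary.Core using (Rel)
open import Relation.Binary.Definitions using (DecidableEquality)
open import Relation.Binary.PropositionalEquality using (_≡_; _≢_)
open import Relation.Nullary.Decidable using (Dec; ¬?)
open import Relation.Unary using (Pred; _∈_; _∉_; _≐_; _∪_; _∩_; _∖_; ∁; ｛_｝)

Position : Set
Position = ℤ × ℤ

_≟_ : DecidableEquality Position
_≟_ = ≡-dec ℤ._≟_ ℤ._≟_

neighbours : Position → List Position
neighbours (x , y) =
  (ℤ.pred x , y) ∷ (ℤ.suc x , y) ∷ (x , ℤ.suc y) ∷ (x , ℤ.pred y) ∷ []

Neighbour : Rel Position 0ℓ
Neighbour p q = q ∈ˡ neighbours p

TwoNeighboursIn : Pred Position 0ℓ → Pred Position 0ℓ
TwoNeighboursIn S p =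
  ∃₂ λ q r → q ≢ r × Neighbour p q × Neighbour p r × q ∈ S × r ∈ S

-- A finite subset of ℤ², listed without repetition.  The order of the listing
-- is immaterial: configurations are compared by _≈_, never by _≡_.
record Configuration : Set where
  field
    coins  : List Position
    unique : Unique coins

open Configuration public

⟦_⟧ : Configuration → Pred Position 0ℓ
⟦ C ⟧ p = p ∈ˡ coins C

infix 4 _≈_
_≈_ : Rel Configuration 0ℓ
A ≈ B = ⟦ A ⟧ ≐ ⟦ B ⟧

∣_∣ : Configuration → ℕ
∣ C ∣ = length (coins C)

infixl 6 _without_
_without_ : Configuration → Position → Configuration
C without c = record
  { coins  = filter (λ q → ¬? (q ≟ c)) (coins C)
  ; unique = filter⁺ (λ q → ¬? (q ≟ c)) (unique C)
  }

Move : Configuration → Position → Position → Configuration → Set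
Move A c p B =
    c ∈ ⟦ A ⟧
  × p ∉ ⟦ A ⟧
  × p ∈ TwoNeighboursIn (⟦ A ⟧ ∖ ｛ c ｝)
  × ⟦ B ⟧ ≐ ((⟦ A ⟧ ∖ ｛ c ｝) ∪ ｛ p ｝)

infix 4 _⟶_ _⟶*_
_⟶_ : Rel Configuration 0ℓ
A ⟶ B = ∃₂ λ c p → Move A c p B

-- The final _≈_ is needed for the empty sequence only, as Move already
-- determines its result up to _≈_.
_⟶*_ : Rel Configuration 0ℓ
A ⟶* B = ∃ λ C → Star _⟶_ A C × C ≈ B

stage : Pred Position 0ℓ → ℕ → Pred Position 0ℓ
stage S zero    = S
stage S (suc i) = stage S i ∪ (∁ (stage S i) ∩ TwoNeighboursIn (stage S i))

-- The limit of the sequence of stages: the positions that belong to all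
-- stages from some index on.
span : Configuration → Pred Position 0ℓ
span C p = ∃[ k ] ∀ i → k ℕ.≤ i → p ∈ stage ⟦ C ⟧ i

record Rectangle : Set where
  field
    left bottom  : ℤ
    width height : ℕ

open Rectangle public

points : Rectangle → Pred Position 0ℓ
points R (x , y) =
    (left R ℤ.≤ x × x ℤ.< left R ℤ.+ + width R)
  × (bottom R ℤ.≤ y × y ℤ.< bottom R ℤ.+ + height R)

Odd : Pred Rectangle 0ℓ
Odd R = parity (width R ℕ.+ height R) ≡ 1ℙ

HasSpan : Configuration → Rectangle → Set
HasSpan C R = span C ≐ points R

Minimum : Pred Configuration 0ℓ
Minimum M = ∀ C → span C ≐ span M → ∣ M ∣ ℕ.≤ ∣ C ∣

Minimum+1 : Pred Configuration 0ℓ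
Minimum+1 A = ∃₂ λ M a →
  Minimum M × span M ≐ span A × a ∉ ⟦ M ⟧ × ⟦ A ⟧ ≐ (⟦ M ⟧ ∪ ｛ a ｝)

Redundant : Configuration → Pred Position 0ℓ
Redundant B b = b ∈ ⟦ B ⟧ × b ∈ TwoNeighboursIn ⟦ B ⟧

-- The configurations on which the poking game with span R is played.
Pokable : Rectangle → Pred Configuration 0ℓ
Pokable R M =
  Minimum M × HasSpan M R
  × (∃₂ λ c₁ c₂ → c₁ ∈ ⟦ M ⟧ × c₂ ∈ ⟦ M ⟧ × Neighbour c₁ c₂)

-- c is either coin of the adjacent pair {c , c′}.
Poke : Rectangle → Rel Configuration 0ℓ
Poke R M M′ =
  Pokable R M
  × (∃₂ λ c c′ → c ∈ ⟦ M ⟧ × c′ ∈ ⟦ M ⟧ × Neighbour c c′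
    × (∃ λ p → Neighbour c p × p ∉ ⟦ M ⟧
      × (∃ λ q → q ∈ ⟦ M ⟧ × q ≢ c × Neighbour p q)
      × ⟦ M′ ⟧ ≐ ((⟦ M ⟧ ∖ ｛ c ｝) ∪ ｛ p ｝)))

PokingInstance : Rectangle → Pred (Configuration × Configuration) 0ℓ
PokingInstance R (M , M′) = Pokable R M × Pokable R M′

PokesTo : Rectangle → Pred (Configuration × Configuration) 0ℓ
PokesTo R (M , M′) =
  PokingInstance R (M , M′) × (∃ λ C → Star (Poke R) M C × C ≈ M′)

-- The pairs (A₁ ∖ {a} , B ∖ {b}) that are instances of the poking game, where
-- A₁ results from a move c₁ ↦ p₁ from A, the coin a ∈ A₁ is a neighbour of p₁
-- and b is redundant in B.
Query : Rectangle → (A B : Configuration) → Pred (Configuration × Configuration) 0ℓ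
Query R A B (M , M′) =
  PokingInstance R (M , M′)
  × (∃₂ λ c₁ p₁ → ∃ λ A₁ → Move A c₁ p₁ A₁
    × (∃₂ λ a b → a ∈ ⟦ A₁ ⟧ × Neighbour p₁ a × Redundant B b
      × M ≈ A₁ without a × M′ ≈ B without b))

-- L enumerates the queries, up to the order in which coins are listed.
EnumeratesQueries : Rectangle → (A B : Configuration) → List (Configuration × Configuration) → Set
EnumeratesQueries R A B L =
    All (Query R A B) L
  × (∀ M M′ → Query R A B (M , M′) → Any (λ (X , X′) → X ≈ M × X′ ≈ M′) L)

-- Deciding A ⟶* B reduces to deciding at most k instances of the poking game.
-- The list of instances is pinned down to be the list of all queries, so that
-- it cannot be chosen depending on the answer to A ⟶* B.
record ReducesToPoking (R : Rectangle) (A B : Configuration) (k : ℕ) : Set where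
  field
    queries    : List (Configuration × Configuration)
    enumerates : EnumeratesQueries R A B queries
    few        : length queries ℕ.≤ k
    correct    : (A ⟶* B) ⇔ (A ≈ B ⊎ A ⟶ B ⊎ Any (PokesTo R) queries)
    decides    : All (λ I → Dec (PokesTo R I)) queries → Dec (A ⟶* B)

{-# OPTIONS --safe #-}

-- A minimum configuration whose span is an odd rectangle has at most one adjacent pair: adding a
-- position with two occupied neighbours does not increase the perimeter, and ⌈(w + h) / 2⌉ coins suffice
-- to span a w × h rectangle.  Consider two successive moves c₁ ↦ p₁ and c₂ ↦ p₂ between minimum+1
-- configurations with the same span.  If c₂ = p₁, they merge into one move or cancel.  Otherwise c₂
-- is a neighbour of p₁, since p₁ and two neighbours of it cannot all remain once c₂ is removed; so
-- c₂ is the coin a of the statement, and every later move acts as a poke on the configuration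
-- without the coin that is about to move.  Conversely, a poke c ↦ p is simulated by moving the
-- surplus coin to p, which makes c the new surplus coin.
module Submission where

open import Defs
open import Level using (0ℓ)
open import Data.Integer.Base as ℤ using (ℤ)
import Data.Integer.Properties as ℤ
open import Algebra.Properties.AbelianGroup ℤ.+-0-abelianGroup using (∙-cancelˡ)
open import Data.List.Base using (List; []; _∷_; _++_; length; filter; map; concatMap; upTo; cartesianProduct; cartesianProductWith; deduplicate)
open import Data.List.Properties using (length-map; length-++; length-++-sucʳ; length-upTo; length-filter; length-deduplicate; filter-notAll)
open import Data.List.Membership.Propositional using (find; lose) renaming (_∈_ to _∈ˡ_)
import Data.List.Membership.DecPropositional as DecMembership
open import Data.List.Membership.Propositional.Properties
open import Data.List.Relation.Binary.Disjoint.Propositional using (Disjoint)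
open import Data.List.Relation.Unary.All as All using (All; []; _∷_; all?)
open import Data.List.Relation.Unary.All.Properties using (¬Any⇒All¬; All¬⇒¬Any)
open import Data.List.Relation.Unary.AllPairs.Core using ([]; _∷_)
open import Data.List.Relation.Unary.Any using (Any; here; there; any?)
open import Data.List.Relation.Unary.Unique.Propositional using (Unique)
import Data.List.Relation.Unary.Unique.Propositional.Properties as Unique
import Data.List.Relation.Unary.Unique.DecPropositional.Properties as UniqueDec
open import Data.Nat.Base as ℕ using (ℕ; zero; suc; parity; _+_; _*_; _^_; _≤_; _<_; _⊔_; z≤n; s≤s)
import Data.Nat.Properties as ℕ
open import Data.Nat.Solver using (module +-*-Solver)
open import Data.Parity.Base using (0ℙ)
open import Data.Product.Base using (∃; ∃₂; _×_; _,_; proj₁; proj₂)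
open import Data.Sum.Base using (_⊎_; inj₁; inj₂; [_,_]′)
open import Function.Base using (_∘_; id; case_of_)
open import Function.Bundles using (_⇔_; mk⇔)
open import Relation.Binary.Construct.Closure.ReflexiveTransitive using (Star; ε; _◅_)
open import Relation.Binary.Core using (Rel)
open import Relation.Binary.PropositionalEquality
open import Relation.Nullary.Decidable using (Dec; yes; no; ¬?; map′; _×-dec_; _⊎-dec_)
open import Relation.Nullary.Negation using (¬_; contradiction)
open import Relation.Unary using (Pred; Decidable; _∈_; _∉_; _⊆_; _≐_; _∪_; _∖_; ｛_｝)

open DecMembership _≟_ using (_∈?_)

-- The obstacle is cancellation. Every later sequence of moves is kept in the form "opening move,
-- pokes, jump of the surplus coin to `b`", and one more move is added in front. If that move
-- cancels the opening move, the form has lost its beginning and a new opening move must be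
-- extracted from the pokes, which may all turn out to be free. Hence the three-way `Outcome`, with
-- room for the cases where nothing or one single move is left. Cardinalities are compared
-- throughout by including a repetition-free list of coins or edges in another list. Since `span` is
-- a predicate, perimeters are counted on a listed configuration that grows by one coin at a time.
-- The constant 128 is 16 times 8. With N coins there are N choices of `c₁`, the ends of 4N edges
-- for `p₁`, four neighbours of `p₁` for `a`, and the starts of at most 8 inner edges of `B` for
-- `b`. The bounded number of choices for `b` is what makes the count quadratic.

unique-⊆-length : {A : Set} {xs ys : List A} → Unique xs →
  (∀ {x} → x ∈ˡ xs → x ∈ˡ ys) → length xs ≤ length ys
unique-⊆-length []          xs⊆ys = z≤n
unique-⊆-length {xs = x ∷ xs} (x∉xs ∷ xs!) xs⊆ys with ∈-∃++ (xs⊆ys (here refl))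
... | as , bs , refl = begin
  suc (length xs)           ≤⟨ s≤s (unique-⊆-length xs! avoid) ⟩
  suc (length (as ++ bs))   ≡⟨ length-++-sucʳ as x bs ⟨
  length (as ++ x ∷ bs)     ∎
  where
  open ℕ.≤-Reasoning
  avoid : ∀ {y} → y ∈ˡ xs → y ∈ˡ as ++ bs
  avoid y∈xs with ∈-++⁻ as (xs⊆ys (there y∈xs))
  ... | inj₁ y∈as         = ∈-++⁺ˡ y∈as
  ... | inj₂ (here refl)  = contradiction y∈xs (All¬⇒¬Any x∉xs)
  ... | inj₂ (there y∈bs) = ∈-++⁺ʳ as y∈bs

-- Closed sets and the neighbour relation

Closed : Pred (Pred Position 0ℓ) 0ℓ
Closed S = TwoNeighboursIn S ⊆ S

twoNeighbours-mono : ∀ {S T} → S ⊆ T → TwoNeighboursIn S ⊆ TwoNeighboursIn T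
twoNeighbours-mono S⊆T (q , r , q≢r , pq , pr , q∈S , r∈S) =
  q , r , q≢r , pq , pr , S⊆T q∈S , S⊆T r∈S

twoNeighbours? : ∀ {S} → Decidable S → Decidable (TwoNeighboursIn S)
twoNeighbours? {S} S? p = map′ to from
  (any? (λ q → any? (λ r → ¬? (q ≟ r) ×-dec S? q ×-dec S? r) (neighbours p)) (neighbours p))
  where
  to : Any (λ q → Any (λ r → q ≢ r × S q × S r) (neighbours p)) (neighbours p) → TwoNeighboursIn S p
  to any with find any
  ... | q , pq , any′ with find any′
  ... | r , pr , q≢r , q∈S , r∈S = q , r , q≢r , pq , pr , q∈S , r∈S
  from : TwoNeighboursIn S p → Any (λ q → Any (λ r → q ≢ r × S q × S r) (neighbours p)) (neighbours p)
  from (q , r , q≢r , pq , pr , q∈S , r∈S) = lose pq (lose pr (q≢r , q∈S , r∈S))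

neighbour-sym : ∀ {p q} → Neighbour p q → Neighbour q p
neighbour-sym {x , y} (here refl) = there (here (cong (_, y) (sym (ℤ.suc-pred x))))
neighbour-sym {x , y} (there (here refl)) = here (cong (_, y) (sym (ℤ.pred-suc x)))
neighbour-sym {x , y} (there (there (here refl))) =
  there (there (there (here (cong (x ,_) (sym (ℤ.pred-suc y))))))
neighbour-sym {x , y} (there (there (there (here refl)))) =
  there (there (here (cong (x ,_) (sym (ℤ.suc-pred y)))))

pred[i]<i : ∀ i → ℤ.pred i ℤ.< i
pred[i]<i i = ℤ.i≤pred[j]⇒i<j ℤ.≤-refl

i<suc[i] : ∀ i → i ℤ.< ℤ.suc i
i<suc[i] i = ℤ.suc[i]≤j⇒i<j ℤ.≤-refl

pred[i]<suc[i] : ∀ i → ℤ.pred i ℤ.< ℤ.suc i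
pred[i]<suc[i] i = ℤ.<-trans (pred[i]<i i) (i<suc[i] i)

neighbour-irrefl : ∀ {p q} → Neighbour p q → p ≢ q
neighbour-irrefl {x , y} (here refl) eq = ℤ.<⇒≢ (pred[i]<i x) (sym (cong proj₁ eq))
neighbour-irrefl {x , y} (there (here refl)) eq = ℤ.<⇒≢ (i<suc[i] x) (cong proj₁ eq)
neighbour-irrefl {x , y} (there (there (here refl))) eq = ℤ.<⇒≢ (i<suc[i] y) (cong proj₂ eq)
neighbour-irrefl {x , y} (there (there (there (here refl)))) eq =
  ℤ.<⇒≢ (pred[i]<i y) (sym (cong proj₂ eq))

neighbours-unique : ∀ p → Unique (neighbours p)
neighbours-unique (x , y) =
    ((ℤ.<⇒≢ (pred[i]<suc[i] x) ∘ cong proj₁)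
      ∷ (ℤ.<⇒≢ (pred[i]<i x) ∘ cong proj₁)
      ∷ (ℤ.<⇒≢ (pred[i]<i x) ∘ cong proj₁) ∷ [])
  ∷ ((ℤ.<⇒≢ (i<suc[i] x) ∘ sym ∘ cong proj₁) ∷ (ℤ.<⇒≢ (i<suc[i] x) ∘ sym ∘ cong proj₁) ∷ [])
  ∷ ((ℤ.<⇒≢ (pred[i]<suc[i] y) ∘ sym ∘ cong proj₂) ∷ [])
  ∷ [] ∷ []

-- Spans

stage-mono : ∀ {S i j} → i ℕ.≤′ j → stage S i ⊆ stage S j
stage-mono ℕ.≤′-refl       p∈S = p∈S
stage-mono (ℕ.≤′-step i≤j) p∈S = inj₁ (stage-mono i≤j p∈S)

stage? : ∀ {S} → Decidable S → ∀ i → Decidable (stage S i)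
stage? S? zero    p = S? p
stage? S? (suc i) p =
  stage? S? i p ⊎-dec (¬? (stage? S? i p) ×-dec twoNeighbours? (stage? S? i) p)

stage⊆span : ∀ C i → stage ⟦ C ⟧ i ⊆ span C
stage⊆span C i p∈ = i , λ j i≤j → stage-mono (ℕ.≤⇒≤′ i≤j) p∈

coins⊆span : ∀ C → ⟦ C ⟧ ⊆ span C
coins⊆span C = stage⊆span C 0

-- The two neighbours may enter at different stages, so both are taken at the later one. A stage
-- adds only positions absent from the previous stage, which is why membership in a stage has to be
-- decided here.
span-closed : ∀ C → Closed (span C)
span-closed C {p} (q , r , q≢r , pq , pr , (k , q∈) , (l , r∈))
  with stage? (_∈? coins C) (k ⊔ l) p
... | yes p∈ = stage⊆span C (k ⊔ l) p∈
... | no  p∉ = stage⊆span C (suc (k ⊔ l))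
  (inj₂ (p∉ , q , r , q≢r , pq , pr , q∈ _ (ℕ.m≤m⊔n k l) , r∈ _ (ℕ.m≤n⊔m k l)))

-- Together with `coins⊆span` and `span-closed` this makes the span the least closed set containing
-- the coins; stages are not unfolded again.
span-least : ∀ {S} C → Closed S → ⟦ C ⟧ ⊆ S → span C ⊆ S
span-least {S} C S-closed C⊆S (k , p∈) = stage⊆ k (p∈ k ℕ.≤-refl)
  where
  stage⊆ : ∀ i → stage ⟦ C ⟧ i ⊆ S
  stage⊆ zero    p∈C              = C⊆S p∈C
  stage⊆ (suc i) (inj₁ p∈)        = stage⊆ i p∈
  stage⊆ (suc i) (inj₂ (_ , two)) = S-closed (twoNeighbours-mono (stage⊆ i) two)

span-mono : ∀ C D → ⟦ C ⟧ ⊆ span D → span C ⊆ span D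
span-mono C D = span-least C (span-closed D)

span-cong : ∀ {C D} → C ≈ D → span C ≐ span D
span-cong {C} {D} (C⊆D , D⊆C) =
  span-mono C D (coins⊆span D ∘ C⊆D) , span-mono D C (coins⊆span C ∘ D⊆C)

insert : ∀ C {p} → p ∉ ⟦ C ⟧ → Configuration
insert C {p} p∉C = record
  { coins  = p ∷ coins C
  ; unique = ¬Any⇒All¬ (coins C) p∉C ∷ unique C
  }

-- One position at a time instead of a whole stage, so that the change of the perimeter can be
-- followed. The result is fixed by `≡` because `outer` is computed from the listing.
Grow : Rel Configuration 0ℓ
Grow C D = ∃ λ p → ∃ λ (p∉C : p ∉ ⟦ C ⟧) → p ∈ TwoNeighboursIn ⟦ C ⟧ × D ≡ insert C p∉C

grow-⊇ : ∀ {C D} → Star Grow C D → ⟦ C ⟧ ⊆ ⟦ D ⟧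
grow-⊇ ε                                    = id
grow-⊇ ((_ , _ , _ , refl) ◅ grows) = grow-⊇ grows ∘ there

grow-⊆ : ∀ {C D S} → Closed S → Star Grow C D → ⟦ C ⟧ ⊆ S → ⟦ D ⟧ ⊆ S
grow-⊆ S-closed ε C⊆S = C⊆S
grow-⊆ S-closed ((p , p∉C , two , refl) ◅ grows) C⊆S =
  grow-⊆ S-closed grows λ where
    (here refl) → S-closed (twoNeighbours-mono C⊆S two)
    (there q∈C) → C⊆S q∈C

-- The number `n` bounds how many positions of `E` are still free. When it reaches zero, another
-- insertion would give more distinct coins than `E` has entries.
saturate : ∀ E C → ⟦ C ⟧ ⊆ (_∈ˡ E) → ∃ λ D → Star Grow C D
  × (∀ {p} → p ∈ˡ E → p ∈ TwoNeighboursIn ⟦ D ⟧ → p ∈ ⟦ D ⟧)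
saturate E C C⊆E = go (length E) C C⊆E (ℕ.m≤m+n _ _)
  where
  go : ∀ n C → ⟦ C ⟧ ⊆ (_∈ˡ E) → length E ≤ n + ∣ C ∣ → ∃ λ D → Star Grow C D
    × (∀ {p} → p ∈ˡ E → p ∈ TwoNeighboursIn ⟦ D ⟧ → p ∈ ⟦ D ⟧)
  go n C C⊆E E≤
    with any? (λ p → ¬? (p ∈? coins C) ×-dec twoNeighbours? (_∈? coins C) p) E
  ... | no none = C , ε , closed
    where
    closed : ∀ {p} → p ∈ˡ E → p ∈ TwoNeighboursIn ⟦ C ⟧ → p ∈ ⟦ C ⟧
    closed {p} p∈E two with p ∈? coins C
    ... | yes p∈C = p∈C
    ... | no  p∉C = contradiction (lose p∈E (p∉C , two)) none
  ... | yes some with find some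
  ... | p , p∈E , p∉C , two = step n E≤
    where
    C′ = insert C p∉C
    C′⊆E : ⟦ C′ ⟧ ⊆ (_∈ˡ E)
    C′⊆E (here refl) = p∈E
    C′⊆E (there q∈C) = C⊆E q∈C
    step : ∀ n → length E ≤ n + ∣ C ∣ → ∃ λ D → Star Grow C D
      × (∀ {p} → p ∈ˡ E → p ∈ TwoNeighboursIn ⟦ D ⟧ → p ∈ ⟦ D ⟧)
    step zero E≤ =
      contradiction (ℕ.≤-trans (unique-⊆-length (unique C′) C′⊆E) E≤) (ℕ.<-irrefl refl)
    step (suc n) E≤ with go n C′ C′⊆E (ℕ.≤-trans E≤ (ℕ.≤-reflexive (sym (ℕ.+-suc n ∣ C ∣))))
    ... | D , grows , D-closed = D , (p , p∉C , two , refl) ◅ grows , D-closed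

-- Perimeters

Edge : Set
Edge = Position × Position

edges : List Position → List Edge
edges = concatMap λ p → map (p ,_) (neighbours p)

∈-edges⁺ : ∀ {xs p q} → p ∈ˡ xs → Neighbour p q → (p , q) ∈ˡ edges xs
∈-edges⁺ {x ∷ xs} (here refl)  pq = ∈-++⁺ˡ (∈-map⁺ (x ,_) pq)
∈-edges⁺ {x ∷ xs} (there p∈xs) pq = ∈-++⁺ʳ (map (x ,_) (neighbours x)) (∈-edges⁺ p∈xs pq)

∈-edges⁻ : ∀ xs {p q} → (p , q) ∈ˡ edges xs → p ∈ˡ xs × Neighbour p q
∈-edges⁻ (x ∷ xs) e∈ with ∈-++⁻ (map (x ,_) (neighbours x)) e∈
... | inj₂ e∈′ = let p∈xs , pq = ∈-edges⁻ xs e∈′ in there p∈xs , pq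
... | inj₁ e∈′ with ∈-map⁻ (x ,_) e∈′
... | _ , pq , refl = here refl , pq

length-edges : ∀ xs → length (edges xs) ≡ 4 * length xs
length-edges []       = refl
length-edges (x ∷ xs) =
  trans (cong (4 +_) (length-edges xs)) (sym (ℕ.*-suc 4 (length xs)))

edges-unique : ∀ {xs} → Unique xs → Unique (edges xs)
edges-unique [] = []
edges-unique {x ∷ xs} (x∉xs ∷ xs!) =
  Unique.++⁺ (Unique.map⁺ {f = x ,_} (cong proj₂) (neighbours-unique x)) (edges-unique xs!) λ where
    (e∈₁ , e∈₂) → case ∈-map⁻ (x ,_) e∈₁ of λ where
      (_ , _ , refl) → All¬⇒¬Any x∉xs (proj₁ (∈-edges⁻ xs e∈₂))

-- Edges are directed: an adjacent pair of coins occurs in `inner` twice, and the length of `outer`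
-- is the perimeter.
inner outer : Configuration → List Edge
inner C = filter (λ e → proj₂ e ∈? coins C) (edges (coins C))
outer C = filter (λ e → ¬? (proj₂ e ∈? coins C)) (edges (coins C))

∈-inner⁺ : ∀ C {p q} → p ∈ ⟦ C ⟧ → q ∈ ⟦ C ⟧ → Neighbour p q → (p , q) ∈ˡ inner C
∈-inner⁺ C p∈C q∈C pq = ∈-filter⁺ (λ e → proj₂ e ∈? coins C) (∈-edges⁺ p∈C pq) q∈C

∈-outer⁺ : ∀ C {p q} → p ∈ ⟦ C ⟧ → q ∉ ⟦ C ⟧ → Neighbour p q → (p , q) ∈ˡ outer C
∈-outer⁺ C p∈C q∉C pq = ∈-filter⁺ (λ e → ¬? (proj₂ e ∈? coins C)) (∈-edges⁺ p∈C pq) q∉C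

∈-outer⁻ : ∀ C {p q} → (p , q) ∈ˡ outer C → p ∈ ⟦ C ⟧ × q ∉ ⟦ C ⟧ × Neighbour p q
∈-outer⁻ C e∈ =
  let e∈edges , q∉C = ∈-filter⁻ (λ e → ¬? (proj₂ e ∈? coins C)) e∈
      p∈C , pq      = ∈-edges⁻ (coins C) e∈edges
  in p∈C , q∉C , pq

outer-unique : ∀ C → Unique (outer C)
outer-unique C = Unique.filter⁺ (λ e → ¬? (proj₂ e ∈? coins C)) (edges-unique (unique C))

outer+inner : ∀ C → length (outer C) + length (inner C) ≤ 4 * ∣ C ∣
outer+inner C = begin
  length (outer C) + length (inner C)  ≡⟨ length-++ (outer C) ⟨
  length (outer C ++ inner C)          ≤⟨ unique-⊆-length both! both⊆ ⟩
  length (edges (coins C))             ≡⟨ length-edges (coins C) ⟩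
  4 * ∣ C ∣                            ∎
  where
  open ℕ.≤-Reasoning
  In? = λ (e : Edge) → proj₂ e ∈? coins C
  both! : Unique (outer C ++ inner C)
  both! = Unique.++⁺ (outer-unique C) (Unique.filter⁺ In? (edges-unique (unique C)))
    λ (e∈outer , e∈inner) →
      proj₂ (∈-filter⁻ (¬? ∘ In?) {xs = edges (coins C)} e∈outer) (proj₂ (∈-filter⁻ In? {xs = edges (coins C)} e∈inner))
  both⊆ : ∀ {e} → e ∈ˡ outer C ++ inner C → e ∈ˡ edges (coins C)
  both⊆ e∈ with ∈-++⁻ (outer C) e∈
  ... | inj₁ e∈outer = proj₁ (∈-filter⁻ (¬? ∘ In?) e∈outer)
  ... | inj₂ e∈inner = proj₁ (∈-filter⁻ In? e∈inner)

-- Filling `p` removes the outer edges from `q` and `r` into `p`, and of the four edges leaving `p`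
-- those to `q` and `r` are not outer. The four edges in `new` are thus disjoint from `outer D`, and
-- with it they still fit into `outer C` plus the four edges leaving `p`.
outer-grow : ∀ {C D} → Grow C D → length (outer D) ≤ length (outer C)
outer-grow {C} (p , p∉C , (q , r , q≢r , pq , pr , q∈C , r∈C) , refl) =
  ℕ.+-cancelʳ-≤ 4 _ _ (begin
    length (outer D) + 4                             ≡⟨ length-++ (outer D) ⟨
    length (outer D ++ new)                          ≤⟨ unique-⊆-length all! all⊆ ⟩
    length (outer C ++ map (p ,_) (neighbours p))    ≡⟨ length-++ (outer C) ⟩
    length (outer C) + 4                             ∎)
  where
  open ℕ.≤-Reasoning
  D = insert C p∉C
  new : List Edge
  new = (q , p) ∷ (r , p) ∷ (p , q) ∷ (p , r) ∷ []
  p≢q = neighbour-irrefl pq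
  p≢r = neighbour-irrefl pr
  new! : Unique new
  new! = ((q≢r ∘ cong proj₁) ∷ (p≢q ∘ cong proj₂) ∷ (p≢r ∘ cong proj₂) ∷ [])
    ∷ ((p≢q ∘ cong proj₂) ∷ (p≢r ∘ cong proj₂) ∷ [])
    ∷ ((q≢r ∘ cong proj₂) ∷ []) ∷ [] ∷ []
  new-inside : ∀ {e} → e ∈ˡ new → proj₂ e ∈ ⟦ D ⟧
  new-inside (here refl)                         = here refl
  new-inside (there (here refl))                 = here refl
  new-inside (there (there (here refl)))         = there q∈C
  new-inside (there (there (there (here refl)))) = there r∈C
  all! : Unique (outer D ++ new)
  all! = Unique.++⁺ (outer-unique D) new!
    λ (e∈outer , e∈new) → proj₁ (proj₂ (∈-outer⁻ D e∈outer)) (new-inside e∈new)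
  outer⊆ : ∀ {e} → e ∈ˡ outer D → e ∈ˡ outer C ++ map (p ,_) (neighbours p)
  outer⊆ e∈ with ∈-outer⁻ D e∈
  ... | here refl , y∉D , xy = ∈-++⁺ʳ (outer C) (∈-map⁺ (p ,_) xy)
  ... | there x∈C , y∉D , xy = ∈-++⁺ˡ (∈-outer⁺ C x∈C (y∉D ∘ there) xy)
  all⊆ : ∀ {e} → e ∈ˡ outer D ++ new → e ∈ˡ outer C ++ map (p ,_) (neighbours p)
  all⊆ e∈ with ∈-++⁻ (outer D) e∈
  ... | inj₁ e∈outer = outer⊆ e∈outer
  ... | inj₂ (here refl) = ∈-++⁺ˡ (∈-outer⁺ C q∈C p∉C (neighbour-sym pq))
  ... | inj₂ (there (here refl)) = ∈-++⁺ˡ (∈-outer⁺ C r∈C p∉C (neighbour-sym pr))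
  ... | inj₂ (there (there (here refl))) = ∈-++⁺ʳ (outer C) (∈-map⁺ (p ,_) pq)
  ... | inj₂ (there (there (there (here refl)))) = ∈-++⁺ʳ (outer C) (∈-map⁺ (p ,_) pr)

outer-grows : ∀ {C D} → Star Grow C D → length (outer D) ≤ length (outer C)
outer-grows ε              = ℕ.≤-refl
outer-grows (grow ◅ grows) = ℕ.≤-trans (outer-grows grows) (outer-grow grow)

-- Rectangles

-- If at most one neighbour of a position outside S lies in S, then S is closed.
closed-if : ∀ {S} (exit : Position → Position) → Decidable S →
  (∀ p q → Neighbour p q → q ∈ S → p ∈ S ⊎ q ≡ exit p) → Closed S
closed-if exit S? exits {p} (q , r , q≢r , pq , pr , q∈S , r∈S)
  with exits p q pq q∈S | exits p r pr r∈S
... | inj₁ p∈S | _        = p∈S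
... | inj₂ _   | inj₁ p∈S = p∈S
... | inj₂ q≡  | inj₂ r≡  = contradiction (trans q≡ (sym r≡)) q≢r

-- A rectangle is an intersection of four half-planes, and from a position outside a half-plane only
-- the step towards its border can lead inside.
points-closed : ∀ R → Closed (points R)
points-closed R two =
    ( closed-if (λ (x , y) → ℤ.suc x , y) (λ p → left R ℤ.≤? proj₁ p)
        (λ where
          p q (here refl) l≤ → inj₁ (ℤ.≤-trans l≤ (ℤ.<⇒≤ (pred[i]<i (proj₁ p))))
          p q (there (here refl)) _ → inj₂ refl
          p q (there (there (here refl))) l≤ → inj₁ l≤
          p q (there (there (there (here refl)))) l≤ → inj₁ l≤)
        (twoNeighbours-mono (proj₁ ∘ proj₁) two)
    , closed-if (λ (x , y) → ℤ.pred x , y) (λ p → proj₁ p ℤ.<? left R ℤ.+ ℤ.+ width R)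
        (λ where
          p q (here refl) _ → inj₂ refl
          p q (there (here refl)) <r → inj₁ (ℤ.<-trans (i<suc[i] (proj₁ p)) <r)
          p q (there (there (here refl))) <r → inj₁ <r
          p q (there (there (there (here refl)))) <r → inj₁ <r)
        (twoNeighbours-mono (proj₂ ∘ proj₁) two))
  , ( closed-if (λ (x , y) → x , ℤ.suc y) (λ p → bottom R ℤ.≤? proj₂ p)
        (λ where
          p q (here refl) b≤ → inj₁ b≤
          p q (there (here refl)) b≤ → inj₁ b≤
          p q (there (there (here refl))) _ → inj₂ refl
          p q (there (there (there (here refl)))) b≤ →
            inj₁ (ℤ.≤-trans b≤ (ℤ.<⇒≤ (pred[i]<i (proj₂ p)))))
        (twoNeighbours-mono (proj₁ ∘ proj₂) two)
    , closed-if (λ (x , y) → x , ℤ.pred y) (λ p → proj₂ p ℤ.<? bottom R ℤ.+ ℤ.+ height R)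
        (λ where
          p q (here refl) <t → inj₁ <t
          p q (there (here refl)) <t → inj₁ <t
          p q (there (there (here refl))) <t → inj₁ (ℤ.<-trans (i<suc[i] (proj₂ p)) <t)
          p q (there (there (there (here refl)))) _ → inj₂ refl)
        (twoNeighbours-mono (proj₂ ∘ proj₂) two))

interval⁺ : ∀ a {i n} → i < n → a ℤ.≤ a ℤ.+ ℤ.+ i × a ℤ.+ ℤ.+ i ℤ.< a ℤ.+ ℤ.+ n
interval⁺ a {i} i<n = ℤ.i≤i+j a (ℤ.+ i) , ℤ.+-monoʳ-< a (ℤ.+<+ i<n)

interval⁻ : ∀ a {x} n → a ℤ.≤ x → x ℤ.< a ℤ.+ ℤ.+ n → ∃ λ i → i < n × x ≡ a ℤ.+ ℤ.+ i
interval⁻ a {x} n a≤x x< = i , i<n , x≡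
  where
  i = ℤ.∣ x ℤ.- a ∣
  x≡ : x ≡ a ℤ.+ ℤ.+ i
  x≡ = sym (trans (cong (λ k → a ℤ.+ k) (ℤ.0≤i⇒+∣i∣≡i (ℤ.i≤j⇒0≤j-i a≤x)))
    (trans (ℤ.+-comm a _) (trans (ℤ.+-assoc x _ a)
      (trans (cong (λ k → x ℤ.+ k) (ℤ.+-inverseˡ a)) (ℤ.+-identityʳ x)))))
  i<n : i < n
  i<n = ℕ.≰⇒> λ n≤i → ℤ.<⇒≱ (subst (ℤ._< a ℤ.+ ℤ.+ n) x≡ x<) (ℤ.+-monoʳ-≤ a (ℤ.+≤+ n≤i))

suc[i+j] : ∀ a j → ℤ.suc (a ℤ.+ ℤ.+ j) ≡ a ℤ.+ ℤ.+ suc j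
suc[i+j] a j = trans (sym (ℤ.+-assoc (ℤ.+ 1) a (ℤ.+ j)))
  (trans (cong (ℤ._+ ℤ.+ j) (ℤ.+-comm (ℤ.+ 1) a)) (ℤ.+-assoc a (ℤ.+ 1) (ℤ.+ j)))

i+-injective : ∀ a {i j} → a ℤ.+ ℤ.+ i ≡ a ℤ.+ ℤ.+ j → i ≡ j
i+-injective a eq = ℤ.+-injective (∙-cancelˡ a _ _ eq)

cell : Rectangle → ℕ → ℕ → Position
cell R i j = left R ℤ.+ ℤ.+ i , bottom R ℤ.+ ℤ.+ j

cell∈points : ∀ R {i j} → i < width R → j < height R → cell R i j ∈ points R
cell∈points R i<w j<h = interval⁺ (left R) i<w , interval⁺ (bottom R) j<h

points⁻ : ∀ R {p} → p ∈ points R → ∃₂ λ i j → i < width R × j < height R × p ≡ cell R i j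
points⁻ R ((l≤x , x<r) , (b≤y , y<t)) with interval⁻ (left R) (width R) l≤x x<r | interval⁻ (bottom R) (height R) b≤y y<t
... | i , i<w , refl | j , j<h , refl = i , j , i<w , j<h , refl

cells : Rectangle → List Position
cells R = cartesianProductWith (cell R) (upTo (width R)) (upTo (height R))

∈-cells⁺ : ∀ R {p} → p ∈ points R → p ∈ˡ cells R
∈-cells⁺ R p∈R with points⁻ R p∈R
... | i , j , i<w , j<h , refl =
  ∈-cartesianProductWith⁺ (cell R) (∈-upTo⁺ i<w) (∈-upTo⁺ j<h)

∈-cells⁻ : ∀ R {p} → p ∈ˡ cells R → p ∈ points R
∈-cells⁻ R p∈ with ∈-cartesianProductWith⁻ (cell R) (upTo (width R)) (upTo (height R)) p∈
... | i , j , i∈ , j∈ , refl = cell∈points R (∈-upTo⁻ i∈) (∈-upTo⁻ j∈)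

cell-right : ∀ R i j → Neighbour (cell R i j) (cell R (suc i) j)
cell-right R i j = there (here (cong (_, _) (sym (suc[i+j] (left R) i))))

cell-above : ∀ R i j → Neighbour (cell R i j) (cell R i (suc j))
cell-above R i j = there (there (here (cong (_ ,_) (sym (suc[i+j] (bottom R) j)))))

cell-injectiveˡ : ∀ R {i i′ j j′} → cell R i j ≡ cell R i′ j′ → i ≡ i′
cell-injectiveˡ R = i+-injective (left R) ∘ cong proj₁

cell-injectiveʳ : ∀ R {i i′ j j′} → cell R i j ≡ cell R i′ j′ → j ≡ j′
cell-injectiveʳ R = i+-injective (bottom R) ∘ cong proj₂

-- Spanning a rectangle from one row and one column

module _ (R : Rectangle) {S} (S-closed : Closed S) where

  fill-row : ∀ {i j} → cell R i j ∈ S → cell R (2 + i) j ∈ S → cell R (1 + i) j ∈ S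
  fill-row {i} {j} p∈S q∈S = S-closed
    ( cell R i j , cell R (2 + i) j , (λ eq → ℕ.<⇒≢ (ℕ.m≤n⇒m≤1+n ℕ.≤-refl) (cell-injectiveˡ R eq))
    , neighbour-sym (cell-right R i j) , cell-right R (suc i) j , p∈S , q∈S)

  fill-column : ∀ {i j} → cell R i j ∈ S → cell R i (2 + j) ∈ S → cell R i (1 + j) ∈ S
  fill-column {i} {j} p∈S q∈S = S-closed
    ( cell R i j , cell R i (2 + j) , (λ eq → ℕ.<⇒≢ (ℕ.m≤n⇒m≤1+n ℕ.≤-refl) (cell-injectiveʳ R eq))
    , neighbour-sym (cell-above R i j) , cell-above R i (suc j) , p∈S , q∈S)

  fill-corner : ∀ {i j} → cell R i (1 + j) ∈ S → cell R (1 + i) j ∈ S → cell R (1 + i) (1 + j) ∈ S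
  fill-corner {i} {j} p∈S q∈S = S-closed
    ( cell R i (1 + j) , cell R (1 + i) j , (λ eq → ℕ.<⇒≢ (ℕ.n<1+n i) (cell-injectiveˡ R eq))
    , neighbour-sym (cell-right R i (suc j)) , neighbour-sym (cell-above R (suc i) j) , p∈S , q∈S)

  -- Away from the first row and column, a cell has its left and its lower neighbour filled before
  -- it.
  fill : ∀ {w h} → (∀ {i} → i ≤ w → cell R i 0 ∈ S) → (∀ {j} → j ≤ h → cell R 0 j ∈ S) →
    ∀ i j → i ≤ w → j ≤ h → cell R i j ∈ S
  fill row column i       zero    i≤w j≤h = row i≤w
  fill row column zero    (suc j) i≤w j≤h = column j≤h
  fill row column (suc i) (suc j) i≤w j≤h = fill-corner
    (fill row column i (suc j) (ℕ.<⇒≤ i≤w) j≤h) (fill row column (suc i) j i≤w (ℕ.<⇒≤ j≤h))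

  points⊆ : ∀ {w h} → width R ≡ suc w → height R ≡ suc h →
    (∀ {i} → i ≤ w → cell R i 0 ∈ S) → (∀ {j} → j ≤ h → cell R 0 j ∈ S) → points R ⊆ S
  points⊆ refl refl row column p∈R with points⁻ R p∈R
  ... | i , j , s≤s i≤w , s≤s j≤h , refl = fill row column i j i≤w j≤h

-- One coin for every two cells of a row or column; 0 is left out because rows and columns share it.
spaced : ℕ → List ℕ
spaced 0             = []
spaced 1             = 1 ∷ []
spaced (suc (suc n)) = 2 + n ∷ spaced n

spaced-≤ : ∀ n {i} → i ∈ˡ spaced n → i ≤ n
spaced-≤ 1             (here refl) = ℕ.≤-refl
spaced-≤ (suc (suc n)) (here refl) = ℕ.≤-refl
spaced-≤ (suc (suc n)) (there i∈)  = ℕ.m≤n⇒m≤1+n (ℕ.m≤n⇒m≤1+n (spaced-≤ n i∈))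

-- There are ⌈n / 2⌉ entries. In `spanning` the number n is one less than a side, so the bound
-- becomes the side itself.
length-spaced : ∀ n → 2 * length (spaced n) ≤ suc n
length-spaced 0             = z≤n
length-spaced 1             = ℕ.≤-refl
length-spaced (suc (suc n)) = begin
  2 * suc (length (spaced n))  ≡⟨ ℕ.*-suc 2 (length (spaced n)) ⟩
  2 + 2 * length (spaced n)    ≤⟨ s≤s (s≤s (length-spaced n)) ⟩
  3 + n                        ∎
  where open ℕ.≤-Reasoning

-- Starting from 0, consecutive entries of `spaced n` are at most two apart, so each gap is a single
-- index between two where `T` already holds.
fill-spaced : ∀ {T : Pred ℕ 0ℓ} → T 0 → (∀ {i} → T i → T (2 + i) → T (1 + i)) →
  ∀ n → (∀ {i} → i ∈ˡ spaced n → T i) → ∀ {i} → i ≤ n → T i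
fill-spaced T0 between zero          T-spaced {zero}  _ = T0
fill-spaced T0 between 1             T-spaced {zero}  _ = T0
fill-spaced T0 between 1             T-spaced {suc zero} _ = T-spaced (here refl)
fill-spaced T0 between 1             T-spaced {suc (suc i)} (s≤s ())
fill-spaced {T} T0 between (suc (suc n)) T-spaced {i} i≤2+n with ℕ.m≤n⇒m<n∨m≡n i≤2+n
... | inj₂ refl = T-spaced (here refl)
... | inj₁ (s≤s i≤1+n) with ℕ.m≤n⇒m<n∨m≡n i≤1+n
... | inj₂ refl = between (fill-spaced T0 between n (T-spaced ∘ there) ℕ.≤-refl) (T-spaced (here refl))
... | inj₁ (s≤s i≤n) = fill-spaced {T} T0 between n (T-spaced ∘ there) i≤n

-- The configuration is an L: a corner and every second cell of the two sides meeting there. For an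
-- odd rectangle parity rounds the bound down to ⌈(width + height) / 2⌉ coins.
spanning : ∀ R {w h} → width R ≡ suc w → height R ≡ suc h →
  ∃ λ C → HasSpan C R × 2 * ∣ C ∣ ≤ 2 + (width R + height R)
spanning R {w} {h} refl refl = C , (span⊆ , points⊆span) , few
  where
  row column : List Position
  row    = map (λ i → cell R i 0) (spaced w)
  column = map (λ j → cell R 0 j) (spaced h)
  listing = cell R 0 0 ∷ row ++ column
  C : Configuration
  -- Only an upper bound on the size is wanted, so removing repetitions replaces a proof that the
  -- listing has none.
  C = record { coins = deduplicate _≟_ listing ; unique = UniqueDec.deduplicate-! _≟_ listing }
  listing⊆C : ∀ {p} → p ∈ˡ listing → p ∈ span C
  listing⊆C = coins⊆span C ∘ ∈-deduplicate⁺ _≟_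
  listing⊆points : ∀ {p} → p ∈ˡ listing → p ∈ points R
  listing⊆points (here refl) = cell∈points R (s≤s z≤n) (s≤s z≤n)
  listing⊆points (there p∈) with ∈-++⁻ row p∈
  ... | inj₁ p∈row with ∈-map⁻ _ p∈row
  ... | i , i∈ , refl = cell∈points R (s≤s (spaced-≤ w i∈)) (s≤s z≤n)
  listing⊆points (there p∈) | inj₂ p∈column with ∈-map⁻ _ p∈column
  ... | j , j∈ , refl = cell∈points R (s≤s z≤n) (s≤s (spaced-≤ h j∈))
  span⊆ : span C ⊆ points R
  span⊆ = span-least C (points-closed R) (listing⊆points ∘ ∈-deduplicate⁻ _≟_ listing)
  points⊆span : points R ⊆ span C
  points⊆span = points⊆ R (span-closed C) refl refl
    (fill-spaced {λ i → cell R i 0 ∈ span C} (listing⊆C (here refl)) (fill-row R (span-closed C)) w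
      (λ i∈ → listing⊆C (there (∈-++⁺ˡ (∈-map⁺ (λ i → cell R i 0) i∈)))))
    (fill-spaced {λ j → cell R 0 j ∈ span C} (listing⊆C (here refl)) (fill-column R (span-closed C)) h
      (λ j∈ → listing⊆C (there (∈-++⁺ʳ row (∈-map⁺ (λ j → cell R 0 j) j∈)))))
  few : 2 * ∣ C ∣ ≤ 2 + (width R + height R)
  few = begin
    2 * ∣ C ∣                                             ≤⟨ ℕ.*-monoʳ-≤ 2 (length-deduplicate _≟_ listing) ⟩
    2 * suc (length (row ++ column))                      ≡⟨ ℕ.*-suc 2 _ ⟩
    2 + 2 * length (row ++ column)                        ≡⟨ cong (λ n → 2 + 2 * n) (length-++ row) ⟩
    2 + 2 * (length row + length column)
      ≡⟨ cong₂ (λ m n → 2 + 2 * (m + n)) (length-map _ (spaced w)) (length-map _ (spaced h)) ⟩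
    2 + 2 * (length (spaced w) + length (spaced h))       ≡⟨ cong (2 +_) (ℕ.*-distribˡ-+ 2 (length (spaced w)) _) ⟩
    2 + (2 * length (spaced w) + 2 * length (spaced h))   ≤⟨ s≤s (s≤s (ℕ.+-mono-≤ (length-spaced w) (length-spaced h))) ⟩
    2 + (suc w + suc h)                                   ∎
    where open ℕ.≤-Reasoning

-- The perimeter of a rectangle

side floor : Rectangle → ℤ → List Position
side R x  = map (λ j → x , bottom R ℤ.+ ℤ.+ j) (upTo (height R))
floor R y = map (λ i → left R ℤ.+ ℤ.+ i , y) (upTo (width R))

∈-side⁻ : ∀ R x {q} → q ∈ˡ side R x → ∃ λ j → j < height R × q ≡ (x , bottom R ℤ.+ ℤ.+ j)
∈-side⁻ R x q∈ with ∈-map⁻ (λ j → x , bottom R ℤ.+ ℤ.+ j) q∈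
... | j , j∈ , q≡ = j , ∈-upTo⁻ j∈ , q≡

∈-floor⁻ : ∀ R y {q} → q ∈ˡ floor R y → ∃ λ i → i < width R × q ≡ (left R ℤ.+ ℤ.+ i , y)
∈-floor⁻ R y q∈ with ∈-map⁻ (λ i → left R ℤ.+ ℤ.+ i , y) q∈
... | i , i∈ , q≡ = i , ∈-upTo⁻ i∈ , q≡

side-unique : ∀ R x → Unique (side R x)
side-unique R x = Unique.map⁺ (i+-injective (bottom R) ∘ cong proj₂) (Unique.upTo⁺ (height R))

floor-unique : ∀ R y → Unique (floor R y)
floor-unique R y = Unique.map⁺ (i+-injective (left R) ∘ cong proj₁) (Unique.upTo⁺ (width R))

side-disjoint : ∀ R {x x′} → x ≢ x′ → Disjoint (side R x) (side R x′)
side-disjoint R {x} {x′} x≢x′ (p∈₁ , p∈₂) with ∈-side⁻ R x p∈₁ | ∈-side⁻ R x′ p∈₂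
... | _ , _ , refl | _ , _ , eq = x≢x′ (cong proj₁ eq)

floor-disjoint : ∀ R {y y′} → y ≢ y′ → Disjoint (floor R y) (floor R y′)
floor-disjoint R {y} {y′} y≢y′ (p∈₁ , p∈₂) with ∈-floor⁻ R y p∈₁ | ∈-floor⁻ R y′ p∈₂
... | _ , _ , refl | _ , _ , eq = y≢y′ (cong proj₂ eq)

-- The positions adjacent to R from outside.  They are pairwise distinct because the corners are
-- left out, and each of them is the target of an outer edge.
rimˣ rimʸ rim : Rectangle → List Position
rimˣ R = side R (ℤ.pred (left R)) ++ side R (left R ℤ.+ ℤ.+ width R)
rimʸ R = floor R (ℤ.pred (bottom R)) ++ floor R (bottom R ℤ.+ ℤ.+ height R)
rim R  = rimˣ R ++ rimʸ R

pred≢+ : ∀ a n → ℤ.pred a ≢ a ℤ.+ ℤ.+ n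
pred≢+ a n = ℤ.<⇒≢ (ℤ.<-≤-trans (pred[i]<i a) (ℤ.i≤i+j a (ℤ.+ n)))

rim-unique : ∀ R → Unique (rim R)
rim-unique R = Unique.++⁺
  (Unique.++⁺ (side-unique R _) (side-unique R _) (side-disjoint R (pred≢+ (left R) (width R))))
  (Unique.++⁺ (floor-unique R _) (floor-unique R _) (floor-disjoint R (pred≢+ (bottom R) (height R))))
  λ (p∈ˣ , p∈ʸ) → apart (proj₂∈rimˣ p∈ˣ) (proj₂∈rimʸ p∈ʸ)
  where
  proj₂∈rimˣ : ∀ {p} → p ∈ˡ rimˣ R → ∃ λ j → j < height R × proj₂ p ≡ bottom R ℤ.+ ℤ.+ j
  proj₂∈rimˣ p∈ with ∈-++⁻ (side R (ℤ.pred (left R))) p∈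
  ... | inj₁ p∈left  = let j , j<h , eq = ∈-side⁻ R _ p∈left in j , j<h , cong proj₂ eq
  ... | inj₂ p∈right = let j , j<h , eq = ∈-side⁻ R _ p∈right in j , j<h , cong proj₂ eq
  proj₂∈rimʸ : ∀ {p} → p ∈ˡ rimʸ R →
    proj₂ p ≡ ℤ.pred (bottom R) ⊎ proj₂ p ≡ bottom R ℤ.+ ℤ.+ height R
  proj₂∈rimʸ p∈ with ∈-++⁻ (floor R (ℤ.pred (bottom R))) p∈
  ... | inj₁ p∈bottom = let _ , _ , eq = ∈-floor⁻ R _ p∈bottom in inj₁ (cong proj₂ eq)
  ... | inj₂ p∈top    = let _ , _ , eq = ∈-floor⁻ R _ p∈top in inj₂ (cong proj₂ eq)
  apart : ∀ {y} → (∃ λ j → j < height R × y ≡ bottom R ℤ.+ ℤ.+ j) →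
    ¬ (y ≡ ℤ.pred (bottom R) ⊎ y ≡ bottom R ℤ.+ ℤ.+ height R)
  apart (j , j<h , y≡) (inj₁ y≡pred) = pred≢+ (bottom R) j (trans (sym y≡pred) y≡)
  apart (j , j<h , y≡) (inj₂ y≡top)  =
    ℕ.<⇒≢ j<h (i+-injective (bottom R) (trans (sym y≡) y≡top))

rim-exit : ∀ R {w h} → width R ≡ suc w → height R ≡ suc h →
  ∀ {q} → q ∈ˡ rim R → ∃ λ p → p ∈ points R × q ∉ points R × Neighbour p q
rim-exit R {w} {h} refl refl q∈ with ∈-++⁻ (rimˣ R) q∈
rim-exit R {w} {h} refl refl q∈ | inj₁ q∈ˣ with ∈-++⁻ (side R (ℤ.pred (left R))) q∈ˣ
... | inj₁ q∈left with ∈-side⁻ R _ q∈left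
... | j , j<h , refl = cell R 0 j , cell∈points R (s≤s z≤n) j<h
  , (λ ((l≤ , _) , _) → ℤ.<⇒≱ (pred[i]<i (left R)) l≤)
  , here (cong (λ x → ℤ.pred x , bottom R ℤ.+ ℤ.+ j) (sym (ℤ.+-identityʳ (left R))))
rim-exit R {w} {h} refl refl q∈ | inj₁ q∈ˣ | inj₂ q∈right with ∈-side⁻ R _ q∈right
... | j , j<h , refl = cell R w j , cell∈points R ℕ.≤-refl j<h
  , (λ ((_ , <r) , _) → ℤ.<-irrefl refl <r)
  , cell-right R w j
rim-exit R {w} {h} refl refl q∈ | inj₂ q∈ʸ with ∈-++⁻ (floor R (ℤ.pred (bottom R))) q∈ʸ
... | inj₁ q∈bottom with ∈-floor⁻ R _ q∈bottom
... | i , i<w , refl = cell R i 0 , cell∈points R i<w (s≤s z≤n)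
  , (λ (_ , (b≤ , _)) → ℤ.<⇒≱ (pred[i]<i (bottom R)) b≤)
  , there (there (there (here
      (cong (λ y → left R ℤ.+ ℤ.+ i , ℤ.pred y) (sym (ℤ.+-identityʳ (bottom R)))))))
rim-exit R {w} {h} refl refl q∈ | inj₂ q∈ʸ | inj₂ q∈top with ∈-floor⁻ R _ q∈top
... | i , i<w , refl = cell R i h , cell∈points R i<w ℕ.≤-refl
  , (λ (_ , (_ , <t)) → ℤ.<-irrefl refl <t)
  , cell-above R i h

length-side : ∀ R x → length (side R x) ≡ height R
length-side R x = trans (length-map _ (upTo (height R))) (length-upTo (height R))

length-floor : ∀ R y → length (floor R y) ≡ width R
length-floor R y = trans (length-map _ (upTo (width R))) (length-upTo (width R))

length-rim : ∀ R → length (rim R) ≡ 2 * (width R + height R)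
length-rim R = begin
  length (rim R)                       ≡⟨ length-++ (rimˣ R) ⟩
  length (rimˣ R) + length (rimʸ R)    ≡⟨ cong₂ _+_
    (trans (length-++ (side R _)) (cong₂ _+_ (length-side R _) (length-side R _)))
    (trans (length-++ (floor R _)) (cong₂ _+_ (length-floor R _) (length-floor R _))) ⟩
  (height R + height R) + (width R + width R)   ≡⟨ cong₂ _+_ (double (height R)) (double (width R)) ⟩
  2 * height R + 2 * width R           ≡⟨ ℕ.*-distribˡ-+ 2 (height R) (width R) ⟨
  2 * (height R + width R)             ≡⟨ cong (2 *_) (ℕ.+-comm (height R) (width R)) ⟩
  2 * (width R + height R)             ∎
  where
  open ≡-Reasoning
  double : ∀ n → n + n ≡ 2 * n
  double n = cong (n +_) (sym (ℕ.+-identityʳ n))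

Inhabited : Pred Rectangle 0ℓ
Inhabited R = ∃₂ λ w h → width R ≡ suc w × height R ≡ suc h

inhabited : ∀ R {p} → p ∈ points R → Inhabited R
inhabited R p∈R with points⁻ R p∈R
... | _ , _ , s≤s {n = w} _ , s≤s {n = h} _ , _ = w , h , refl , refl

outer-rectangle : ∀ R → Inhabited R → ∀ {D} → ⟦ D ⟧ ≐ points R →
  2 * (width R + height R) ≤ length (outer D)
outer-rectangle R (w , h , w≡ , h≡) {D} (D⊆R , R⊆D) = begin
  2 * (width R + height R)       ≡⟨ length-rim R ⟨
  length (rim R)                 ≤⟨ unique-⊆-length (rim-unique R) rim⊆ ⟩
  length (map proj₂ (outer D))   ≡⟨ length-map proj₂ (outer D) ⟩
  length (outer D)               ∎
  where
  open ℕ.≤-Reasoning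
  rim⊆ : ∀ {q} → q ∈ˡ rim R → q ∈ˡ map proj₂ (outer D)
  rim⊆ q∈ with rim-exit R w≡ h≡ q∈
  ... | p , p∈R , q∉R , pq = ∈-map⁺ proj₂ (∈-outer⁺ D (R⊆D p∈R) (q∉R ∘ D⊆R) pq)

-- Replaces the predicate `span C` by a listed configuration, on which perimeters can be counted and
-- membership decided. Closure within `cells R` is enough: since `R` is closed, every position with
-- two neighbours in `D` lies in `R`.
saturation : ∀ R C → ⟦ C ⟧ ⊆ points R → ∃ λ D → Star Grow C D × span C ≐ ⟦ D ⟧
saturation R C C⊆R = D , grows , span-least C closed (grow-⊇ grows)
  , grow-⊆ {S = span C} (span-closed C) grows (coins⊆span C)
  where
  saturated = saturate (cells R) C λ p∈C → ∈-cells⁺ R (C⊆R p∈C)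
  D = proj₁ saturated
  grows = proj₁ (proj₂ saturated)
  D⊆R : ⟦ D ⟧ ⊆ points R
  D⊆R = grow-⊆ {S = points R} (points-closed R) grows C⊆R
  closed : Closed ⟦ D ⟧
  closed {p} two = proj₂ (proj₂ saturated) (∈-cells⁺ R (points-closed R two′)) two
    where
    two′ : p ∈ TwoNeighboursIn (points R)
    two′ = twoNeighbours-mono {⟦ D ⟧} {points R} D⊆R two

hasSpan? : ∀ R C → Dec (HasSpan C R)
hasSpan? R C with all? (_∈? cells R) (coins C)
... | no ¬C⊆R = no λ (span⊆R , _) →
  ¬C⊆R (All.tabulate λ p∈C → ∈-cells⁺ R (span⊆R (coins⊆span C p∈C)))
... | yes C⊆cells = map′ to from (all? (_∈? coins D) (cells R))
  where
  C⊆R : ⟦ C ⟧ ⊆ points R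
  C⊆R p∈C = ∈-cells⁻ R (All.lookup C⊆cells p∈C)
  saturated = saturation R C C⊆R
  D = proj₁ saturated
  span≐D = proj₂ (proj₂ saturated)
  to : All (_∈ˡ coins D) (cells R) → HasSpan C R
  to R⊆D = span-least C (points-closed R) C⊆R
    , λ p∈R → proj₂ span≐D (All.lookup R⊆D (∈-cells⁺ R p∈R))
  from : HasSpan C R → All (_∈ˡ coins D) (cells R)
  from (_ , R⊆span) = All.tabulate λ p∈ → proj₁ span≐D (R⊆span (∈-cells⁻ R p∈))

-- Saturating `C` does not increase the perimeter and ends with a listing of `R`. The inner edges of
-- `C` come on top, and `C` has only four edges per coin.
perimeter : ∀ R → Inhabited R → ∀ C → HasSpan C R →
  2 * (width R + height R) + length (inner C) ≤ 4 * ∣ C ∣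
perimeter R inh C (span⊆R , R⊆span) = begin
  2 * (width R + height R) + length (inner C)
    ≤⟨ ℕ.+-monoˡ-≤ (length (inner C)) (outer-rectangle R inh {D} D≐R) ⟩
  length (outer D) + length (inner C)   ≤⟨ ℕ.+-monoˡ-≤ (length (inner C)) (outer-grows grows) ⟩
  length (outer C) + length (inner C)   ≤⟨ outer+inner C ⟩
  4 * ∣ C ∣                             ∎
  where
  open ℕ.≤-Reasoning
  saturated = saturation R C λ p∈C → span⊆R (coins⊆span C p∈C)
  D = proj₁ saturated
  grows = proj₁ (proj₂ saturated)
  span≐D = proj₂ (proj₂ saturated)
  D≐R : ⟦ D ⟧ ≐ points R
  D≐R = (λ p∈D → span⊆R (proj₂ span≐D p∈D)) , (λ p∈R → proj₁ span≐D (R⊆span p∈R))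

sameSpan : ∀ {R C D} → HasSpan C R → HasSpan D R → span C ≐ span D
sameSpan (C⊆R , R⊆C) (D⊆R , R⊆D) = (λ p∈ → R⊆D (C⊆R p∈)) , (λ p∈ → R⊆C (D⊆R p∈))

-- Minimum configurations and their adjacent pairs

few⇒minimum : ∀ {R M} → Minimum M → HasSpan M R → ∀ C → HasSpan C R → ∣ C ∣ ≤ ∣ M ∣ → Minimum C
few⇒minimum M-min M-span C C-span C≤M E spanE≐ = ℕ.≤-trans C≤M (M-min E
  ( (λ p∈ → proj₂ M-span (proj₁ C-span (proj₁ spanE≐ p∈)))
  , (λ p∈ → proj₂ spanE≐ (proj₂ C-span (proj₁ M-span p∈)))))

minimum-few : ∀ R → Inhabited R → ∀ M → Minimum M → HasSpan M R →
  2 * ∣ M ∣ ≤ 2 + (width R + height R)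
minimum-few R (w , h , w≡ , h≡) M M-min M-span =
  let C , C-span , few = spanning R w≡ h≡
  in ℕ.≤-trans (ℕ.*-monoʳ-≤ 2 (M-min C (sameSpan {R} {C} {M} C-span M-span))) few

parity-double : ∀ n → parity (2 * n) ≡ 0ℙ
parity-double zero    = refl
parity-double (suc n) = trans (cong parity (ℕ.*-suc 2 n)) (parity-double n)

-- Four inner edges would turn the perimeter bound into `2 + n ≤ 2 * ∣ M ∣`. The L-shaped
-- configuration gives the opposite inequality, and equality contradicts the oddness of `n`.
minimum-inner-< : ∀ R → Odd R → ∀ M → Minimum M → HasSpan M R → Inhabited R →
  length (inner M) < 4
minimum-inner-< R odd M M-min M-span inh = ℕ.≰⇒> λ 4≤ →
  even (ℕ.≤-antisym (minimum-few R inh M M-min M-span) (ℕ.*-cancelˡ-≤ 2 (lower 4≤)))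
  where
  open ℕ.≤-Reasoning
  n = width R + height R
  lower : 4 ≤ length (inner M) → 2 * (2 + n) ≤ 2 * (2 * ∣ M ∣)
  lower 4≤ = begin
    2 * (2 + n)                 ≡⟨ ℕ.*-distribˡ-+ 2 2 n ⟩
    4 + 2 * n                   ≡⟨ ℕ.+-comm 4 (2 * n) ⟩
    2 * n + 4                   ≤⟨ ℕ.+-monoʳ-≤ (2 * n) 4≤ ⟩
    2 * n + length (inner M)    ≤⟨ perimeter R inh M M-span ⟩
    4 * ∣ M ∣                   ≡⟨ ℕ.*-assoc 2 2 ∣ M ∣ ⟩
    2 * (2 * ∣ M ∣)             ∎
  even : 2 * ∣ M ∣ ≢ 2 + n
  even eq with trans (sym (parity-double ∣ M ∣)) (trans (cong parity eq) odd)
  ... | ()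

-- Two different pairs, each read in both directions, would be four distinct inner edges.
oneAdjacentPair : ∀ R → Odd R → ∀ M → Minimum M → HasSpan M R → ∀ {x y u v} →
  x ∈ ⟦ M ⟧ → y ∈ ⟦ M ⟧ → Neighbour x y → u ∈ ⟦ M ⟧ → v ∈ ⟦ M ⟧ → Neighbour u v →
  u ≡ x × v ≡ y ⊎ u ≡ y × v ≡ x
oneAdjacentPair R odd M M-min M-span {x} {y} {u} {v} x∈ y∈ xy u∈ v∈ uv
  with (u ≟ x) ×-dec (v ≟ y) | (u ≟ y) ×-dec (v ≟ x)
... | yes same | _        = inj₁ same
... | no _     | yes swap = inj₂ swap
... | no ¬same | no ¬swap = contradiction (unique-⊆-length four! four⊆)
  (ℕ.<⇒≱ (minimum-inner-< R odd M M-min M-span (inhabited R (proj₁ M-span (coins⊆span M x∈)))))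
  where
  four : List Edge
  four = (x , y) ∷ (y , x) ∷ (u , v) ∷ (v , u) ∷ []
  four! : Unique four
  four! =
      ((neighbour-irrefl xy ∘ cong proj₁)
        ∷ (λ eq → ¬same (sym (cong proj₁ eq) , sym (cong proj₂ eq)))
        ∷ (λ eq → ¬swap (sym (cong proj₂ eq) , sym (cong proj₁ eq))) ∷ [])
    ∷ ((λ eq → ¬swap (sym (cong proj₁ eq) , sym (cong proj₂ eq)))
        ∷ (λ eq → ¬same (sym (cong proj₂ eq) , sym (cong proj₁ eq))) ∷ [])
    ∷ ((neighbour-irrefl uv ∘ cong proj₁) ∷ [])
    ∷ [] ∷ []
  four⊆ : ∀ {e} → e ∈ˡ four → e ∈ˡ inner M
  four⊆ (here refl)                         = ∈-inner⁺ M x∈ y∈ xy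
  four⊆ (there (here refl))                 = ∈-inner⁺ M y∈ x∈ (neighbour-sym xy)
  four⊆ (there (there (here refl)))         = ∈-inner⁺ M u∈ v∈ uv
  four⊆ (there (there (there (here refl)))) = ∈-inner⁺ M v∈ u∈ (neighbour-sym uv)

-- Moves and pokes

≈-sym : ∀ {C D} → C ≈ D → D ≈ C
≈-sym (C⊆D , D⊆C) = D⊆C , C⊆D

≈-trans : ∀ {C D E} → C ≈ D → D ≈ E → C ≈ E
≈-trans (C⊆D , D⊆C) (D⊆E , E⊆D) = (λ p∈ → D⊆E (C⊆D p∈)) , (λ p∈ → D⊆C (E⊆D p∈))

size-mono : ∀ C D → ⟦ C ⟧ ⊆ ⟦ D ⟧ → ∣ C ∣ ≤ ∣ D ∣
size-mono C D C⊆D = unique-⊆-length (unique C) C⊆D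

∈-without⁺ : ∀ C {c p} → p ∈ ⟦ C ⟧ → c ≢ p → p ∈ ⟦ C without c ⟧
∈-without⁺ C {c} p∈C c≢p = ∈-filter⁺ (λ q → ¬? (q ≟ c)) p∈C (c≢p ∘ sym)

∈-without⁻ : ∀ C {c p} → p ∈ ⟦ C without c ⟧ → p ∈ ⟦ C ⟧ × c ≢ p
∈-without⁻ C {c} p∈ =
  let p∈C , p≢c = ∈-filter⁻ (λ q → ¬? (q ≟ c)) {xs = coins C} p∈ in p∈C , p≢c ∘ sym

without-cong : ∀ {C D} c → C ≈ D → C without c ≈ D without c
without-cong {C} {D} c (C⊆D , D⊆C) =
    (λ p∈ → let p∈C , c≢p = ∈-without⁻ C p∈ in ∈-without⁺ D (C⊆D p∈C) c≢p)
  , (λ p∈ → let p∈D , c≢p = ∈-without⁻ D p∈ in ∈-without⁺ C (D⊆C p∈D) c≢p)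

size-without : ∀ C {c} → c ∈ ⟦ C ⟧ → ∣ C without c ∣ < ∣ C ∣
size-without C {c} c∈C =
  filter-notAll (λ q → ¬? (q ≟ c)) (coins C) (lose c∈C λ c≢c → c≢c refl)

-- Total, so that `A [ c ↦ p ]` makes sense for every choice of positions, before it is known
-- whether `c ↦ p` is a legal move.
place : Configuration → Position → Configuration
place C p with p ∈? coins C
... | yes _   = C
... | no  p∉C = insert C p∉C

∈-place-new : ∀ C p → p ∈ ⟦ place C p ⟧
∈-place-new C p with p ∈? coins C
... | yes p∈C = p∈C
... | no  _   = here refl

∈-place⁺ : ∀ C p → ⟦ C ⟧ ⊆ ⟦ place C p ⟧
∈-place⁺ C p q∈C with p ∈? coins C
... | yes _ = q∈C
... | no  _ = there q∈C

∈-place⁻ : ∀ C p {q} → q ∈ ⟦ place C p ⟧ → q ∈ ⟦ C ⟧ ⊎ p ≡ q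
∈-place⁻ C p q∈ with p ∈? coins C
∈-place⁻ C p q∈          | yes _ = inj₁ q∈
∈-place⁻ C p (here refl) | no  _ = inj₂ refl
∈-place⁻ C p (there q∈C) | no  _ = inj₁ q∈C

size-place : ∀ C p → ∣ place C p ∣ ≤ suc ∣ C ∣
size-place C p with p ∈? coins C
... | yes _ = ℕ.n≤1+n _
... | no  _ = ℕ.≤-refl

_[_↦_] : Configuration → Position → Position → Configuration
A [ c ↦ p ] = place (A without c) p

Moved : Configuration → Position → Position → Pred Position 0ℓ
Moved A c p = (⟦ A ⟧ ∖ ｛ c ｝) ∪ ｛ p ｝

moved : ∀ A c p → ⟦ A [ c ↦ p ] ⟧ ≐ Moved A c p
moved A c p = to , from
  where
  to : ⟦ A [ c ↦ p ] ⟧ ⊆ Moved A c p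
  to q∈ with ∈-place⁻ (A without c) p q∈
  ... | inj₁ q∈A∖c = inj₁ (∈-without⁻ A q∈A∖c)
  ... | inj₂ p≡q   = inj₂ p≡q
  from : Moved A c p ⊆ ⟦ A [ c ↦ p ] ⟧
  from (inj₁ (q∈A , c≢q)) = ∈-place⁺ (A without c) p (∈-without⁺ A q∈A c≢q)
  from (inj₂ refl)        = ∈-place-new (A without c) p

moved-≈ : ∀ {A c p B} → ⟦ B ⟧ ≐ Moved A c p → B ≈ A [ c ↦ p ]
moved-≈ {A} {c} {p} (B⊆ , B⊇) =
  (λ q∈ → proj₂ (moved A c p) (B⊆ q∈)) , (λ q∈ → B⊇ (proj₁ (moved A c p) q∈))

≈-moved : ∀ {A c p B C} → B ≈ C → ⟦ B ⟧ ≐ Moved A c p → ⟦ C ⟧ ≐ Moved A c p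
≈-moved (B⊆C , C⊆B) (B⊆ , B⊇) = (λ q∈ → B⊆ (C⊆B q∈)) , (λ q∈ → B⊆C (B⊇ q∈))

move-size : ∀ {A c p B} → Move A c p B → ∣ B ∣ ≤ ∣ A ∣
move-size {A} {c} {p} {B} (c∈A , _ , _ , B≐) = begin
  ∣ B ∣                      ≤⟨ size-mono B (A [ c ↦ p ]) (proj₁ (moved-≈ {A} {c} {p} {B} B≐)) ⟩
  ∣ A [ c ↦ p ] ∣            ≤⟨ size-place (A without c) p ⟩
  suc ∣ A without c ∣        ≤⟨ size-without A c∈A ⟩
  ∣ A ∣                      ∎
  where open ℕ.≤-Reasoning

-- The new coin rests on two coins that stay, so it lies in the span of those. Hence if the result
-- of a move spans `R`, so do the coins that did not move.
move-span : ∀ {A c p B} → Move A c p B → span B ⊆ span (A without c)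
move-span {A} {c} {p} {B} (_ , _ , two , B≐) = span-mono B (A without c) B⊆
  where
  B⊆ : ⟦ B ⟧ ⊆ span (A without c)
  B⊆ q∈B with proj₁ B≐ q∈B
  ... | inj₁ (q∈A , c≢q) = coins⊆span (A without c) (∈-without⁺ A q∈A c≢q)
  ... | inj₂ refl        = span-closed (A without c)
    (twoNeighbours-mono (λ (q∈A , c≢q) → coins⊆span (A without c) (∈-without⁺ A q∈A c≢q)) two)

without-span : ∀ A c → span (A without c) ⊆ span A
without-span A c = span-mono (A without c) A (λ q∈ → coins⊆span A (proj₁ (∈-without⁻ A q∈)))

moves-span : ∀ {A B} → Star _⟶_ A B → span B ⊆ span A
moves-span ε p∈ = p∈
moves-span {A} (_◅_ {j = A′} (c , p , move) moves) q∈ =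
  without-span A c (move-span {A} {c} {p} {A′} move (moves-span moves q∈))

minimum-cong : ∀ {C D} → C ≈ D → Minimum C → Minimum D
minimum-cong {C} {D} C≈D C-min E spanE≐ =
  let spanC≐ = span-cong {C} {D} C≈D
  in ℕ.≤-trans (size-mono D C (proj₂ C≈D))
    (C-min E ((λ p∈ → proj₂ spanC≐ (proj₁ spanE≐ p∈)) , (λ p∈ → proj₂ spanE≐ (proj₁ spanC≐ p∈))))

hasSpan-cong : ∀ {R C D} → C ≈ D → HasSpan C R → HasSpan D R
hasSpan-cong {R} {C} {D} C≈D (⊆R , R⊆) =
  let spanC≐ = span-cong {C} {D} C≈D
  in (λ p∈ → ⊆R (proj₂ spanC≐ p∈)) , (λ p∈ → proj₁ spanC≐ (R⊆ p∈))

pokable-cong : ∀ {R C D} → C ≈ D → Pokable R C → Pokable R D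
pokable-cong {R} {C} {D} C≈D (C-min , C-span , c₁ , c₂ , c₁∈ , c₂∈ , c₁c₂) =
  minimum-cong {C} {D} C≈D C-min , hasSpan-cong {R} {C} {D} C≈D C-span
  , c₁ , c₂ , proj₁ C≈D c₁∈ , proj₁ C≈D c₂∈ , c₁c₂

poke-congˡ : ∀ {R M N M′} → M ≈ N → Poke R M M′ → Poke R N M′
poke-congˡ {R} {M} {N} M≈N@(M⊆N , N⊆M)
  (M-pokable , c , c′ , c∈ , c′∈ , cc′ , p , cp , p∉ , (q , q∈ , q≢c , pq) , sub , sup) =
  pokable-cong {R} {M} {N} M≈N M-pokable
  , c , c′ , M⊆N c∈ , M⊆N c′∈ , cc′ , p , cp , (λ p∈N → p∉ (N⊆M p∈N)) , (q , M⊆N q∈ , q≢c , pq)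
  , (λ r∈ → case sub r∈ of λ where
      (inj₁ (r∈M , c≢r)) → inj₁ (M⊆N r∈M , c≢r)
      (inj₂ p≡r)         → inj₂ p≡r)
  , λ where
      (inj₁ (r∈N , c≢r)) → sup (inj₁ (N⊆M r∈N , c≢r))
      (inj₂ p≡r)         → sup (inj₂ p≡r)

pokes-congˡ : ∀ {R M N C} → M ≈ N → Star (Poke R) M C → ∃ λ D → Star (Poke R) N D × D ≈ C
pokes-congˡ {R} {M} {N} M≈N ε = N , ε , ≈-sym {M} {N} M≈N
pokes-congˡ {R} {M} {N} {C} M≈N (_◅_ {j = M′} poke pokes) =
  C , poke-congˡ {R} {M} {N} {M′} M≈N poke ◅ pokes , id , id

pokesTo-cong : ∀ {R M M′ N N′} → M ≈ N → M′ ≈ N′ → PokesTo R (M , M′) → PokesTo R (N , N′)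
pokesTo-cong {R} {M} {M′} {N} {N′} M≈N M′≈N′ ((M-pokable , M′-pokable) , C , pokes , C≈M′) =
  let D , pokes′ , D≈C = pokes-congˡ {R} {M} {N} {C} M≈N pokes
  in (pokable-cong {R} {M} {N} M≈N M-pokable , pokable-cong {R} {M′} {N′} M′≈N′ M′-pokable)
    , D , pokes′ , ≈-trans {D} {C} {N′} D≈C (≈-trans {C} {M′} {N′} C≈M′ M′≈N′)

pokes-pokable : ∀ {R M C} → Star (Poke R) M C → Pokable R C → Pokable R M
pokes-pokable ε            C-pokable = C-pokable
pokes-pokable (poke ◅ _)   _         = proj₁ poke

-- Simulating pokes by moves

redundant-two : ∀ {B b} → Redundant B b → b ∈ TwoNeighboursIn ⟦ B without b ⟧
redundant-two {B} (_ , q , r , q≢r , bq , br , q∈B , r∈B) =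
  q , r , q≢r , bq , br , ∈-without⁺ B q∈B (neighbour-irrefl bq) , ∈-without⁺ B r∈B (neighbour-irrefl br)

same-without : ∀ {A B a b} → a ∈ ⟦ A ⟧ → b ∈ ⟦ B ⟧ → a ≡ b → A without a ≈ B without b → A ≈ B
same-without {A} {B} {a} a∈A b∈B refl (sub , sup) = to , from
  where
  to : ⟦ A ⟧ ⊆ ⟦ B ⟧
  to {p} p∈A with a ≟ p
  ... | yes refl = b∈B
  ... | no  a≢p  = proj₁ (∈-without⁻ B (sub (∈-without⁺ A p∈A a≢p)))
  from : ⟦ B ⟧ ⊆ ⟦ A ⟧
  from {p} p∈B with a ≟ p
  ... | yes refl = a∈A
  ... | no  a≢p  = proj₁ (∈-without⁻ A (sup (∈-without⁺ B p∈B a≢p)))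

-- The configurations agree apart from `a` and `b`, so `a` can jump to `b` at once; the redundancy
-- of `b` supplies the two neighbours.
move-free : ∀ {A B a b} → a ∈ ⟦ A ⟧ → Redundant B b → A without a ≈ B without b →
  A ≈ B ⊎ Move A a b B
move-free {A} {B} {a} {b} a∈A red@(b∈B , _) A≈B@(sub , sup) with a ≟ b
... | yes a≡b = inj₁ (same-without {A} {B} a∈A b∈B a≡b A≈B)
... | no  a≢b = inj₂
  ( a∈A
  , (λ b∈A → proj₂ (∈-without⁻ B (sub (∈-without⁺ A b∈A a≢b))) refl)
  , twoNeighbours-mono (λ q∈ → ∈-without⁻ A (sup q∈)) (redundant-two {B} red)
  , to , from)
  where
  to : ⟦ B ⟧ ⊆ Moved A a b
  to {p} p∈B with b ≟ p
  ... | yes b≡p = inj₂ b≡p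
  ... | no  b≢p = inj₁ (∈-without⁻ A (sup (∈-without⁺ B p∈B b≢p)))
  from : Moved A a b ⊆ ⟦ B ⟧
  from (inj₁ (p∈A , a≢p)) = proj₁ (∈-without⁻ B (sub (∈-without⁺ A p∈A a≢p)))
  from (inj₂ refl)        = b∈B

-- A poke c ↦ p of M is simulated in A = M ∪ {a} by moving a to p, after which c is the free coin;
-- nothing has to be moved if p is a itself.
poke-step : ∀ {R A M M′ a} → a ∈ ⟦ A ⟧ → M ≈ A without a → Poke R M M′ →
  (∃ λ c → c ∈ ⟦ A ⟧ × M′ ≈ A without c)
  ⊎ (∃₂ λ p c → ∃ λ A₁ → Move A a p A₁ × c ∈ ⟦ A₁ ⟧ × Neighbour p c × M′ ≈ A₁ without c)
poke-step {R} {A} {M} {M′} {a} a∈A (M⊆ , M⊇)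
  (_ , c , _ , c∈M , _ , _ , p , cp , p∉M , (q , q∈M , q≢c , pq) , M′⊆ , M′⊇) =
  byCases (a ≟ p)
  where
  c≢p : c ≢ p
  c≢p = neighbour-irrefl cp
  A₁ = A [ a ↦ p ]
  M⊆A : ⟦ M ⟧ ⊆ ⟦ A ⟧
  M⊆A x∈M = proj₁ (∈-without⁻ A (M⊆ x∈M))
  M⊆A₁ : ⟦ M ⟧ ⊆ ⟦ A₁ ⟧
  M⊆A₁ x∈M = ∈-place⁺ (A without a) p (M⊆ x∈M)
  remaining : ∀ {X} → ⟦ M ⟧ ⊆ ⟦ X ⟧ → p ∈ ⟦ X ⟧ → (∀ {x} → x ∈ ⟦ X ⟧ → x ∈ ⟦ M ⟧ ⊎ p ≡ x) →
    M′ ≈ X without c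
  remaining {X} M⊆X p∈X X⊆ =
      (λ x∈ → case M′⊆ x∈ of λ where
        (inj₁ (x∈M , c≢x)) → ∈-without⁺ X (M⊆X x∈M) c≢x
        (inj₂ refl)        → ∈-without⁺ X p∈X c≢p)
    , (λ x∈ → let x∈X , c≢x = ∈-without⁻ X x∈ in case X⊆ x∈X of λ where
        (inj₁ x∈M) → M′⊇ (inj₁ (x∈M , c≢x))
        (inj₂ p≡x) → M′⊇ (inj₂ p≡x))
  byCases : Dec (a ≡ p) → _
  byCases (yes refl) = inj₁ (c , M⊆A c∈M , remaining {A} M⊆A a∈A A⊆)
    where
    A⊆ : ∀ {x} → x ∈ ⟦ A ⟧ → x ∈ ⟦ M ⟧ ⊎ a ≡ x
    A⊆ {x} x∈A with a ≟ x
    ... | yes a≡x = inj₂ a≡x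
    ... | no  a≢x = inj₁ (M⊇ (∈-without⁺ A x∈A a≢x))
  byCases (no a≢p) = inj₂
    ( p , c , A₁
    , ( a∈A
      , (λ p∈A → p∉M (M⊇ (∈-without⁺ A p∈A a≢p)))
      , (q , c , q≢c , pq , neighbour-sym cp , ∈-without⁻ A (M⊆ q∈M) , ∈-without⁻ A (M⊆ c∈M))
      , moved A a p)
    , M⊆A₁ c∈M , neighbour-sym cp
    , remaining {A₁} M⊆A₁ (∈-place-new (A without a) p) A₁⊆)
    where
    A₁⊆ : ∀ {x} → x ∈ ⟦ A₁ ⟧ → x ∈ ⟦ M ⟧ ⊎ p ≡ x
    A₁⊆ x∈ with ∈-place⁻ (A without a) p x∈
    ... | inj₁ x∈A∖a = inj₁ (M⊇ x∈A∖a)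
    ... | inj₂ p≡x   = inj₂ p≡x

-- The invariant is that the poked configuration is the current one without its surplus coin. After
-- the last poke the surplus coin jumps to `b`.
pokes⇒moves : ∀ {R A B M C a b} → a ∈ ⟦ A ⟧ → M ≈ A without a → Star (Poke R) M C →
  C ≈ B without b → Redundant B b → A ⟶* B
pokes⇒moves {R} {A} {B} {M} {_} {a} {b} a∈A M≈ ε C≈ red
  with move-free {A} {B} {a} {b} a∈A red
    (≈-trans {A without a} {M} {B without b} (≈-sym {M} {A without a} M≈) C≈)
... | inj₁ A≈B  = A , ε , A≈B
... | inj₂ move = B , (a , b , move) ◅ ε , id , id
pokes⇒moves {R} {A} {B} {M} {C} {a} {b} a∈A M≈ (_◅_ {j = M′} poke pokes) C≈ red
  with poke-step {R} {A} {M} {M′} a∈A M≈ poke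
... | inj₁ (c , c∈A , M′≈) = pokes⇒moves {R} {A} {B} {M′} {C} c∈A M′≈ pokes C≈ red
... | inj₂ (p , c , A₁ , move , c∈A₁ , _ , M′≈) =
  let D , moves , D≈B = pokes⇒moves {R} {A₁} {B} {M′} {C} c∈A₁ M′≈ pokes C≈ red
  in D , (a , p , move) ◅ moves , D≈B

ViaPokes : Rectangle → Configuration → Configuration → Set
ViaPokes R A B = ∃₂ λ c₁ p₁ → ∃ λ A₁ → Move A c₁ p₁ A₁
  × (∃₂ λ a b → a ∈ ⟦ A₁ ⟧ × Neighbour p₁ a × Redundant B b
    × PokesTo R (A₁ without a , B without b))

Outcome : Rectangle → Configuration → Configuration → Set
Outcome R A B = A ≈ B ⊎ A ⟶ B ⊎ ViaPokes R A B

-- Needed when no opening move is available. Pokes onto the surplus coin cost nothing; the first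
-- other poke becomes the opening move, and the coin it frees is a neighbour of the target, as
-- `ViaPokes` demands. If there is no such poke, at most one move remains.
pokes⇒outcome : ∀ {R A B M C a b} → a ∈ ⟦ A ⟧ → M ≈ A without a → Star (Poke R) M C →
  C ≈ B without b → Redundant B b → Pokable R (B without b) → Outcome R A B
pokes⇒outcome {R} {A} {B} {M} {_} {a} {b} a∈A M≈ ε C≈ red _
  with move-free {A} {B} {a} {b} a∈A red
    (≈-trans {A without a} {M} {B without b} (≈-sym {M} {A without a} M≈) C≈)
... | inj₁ A≈B  = inj₁ A≈B
... | inj₂ move = inj₂ (inj₁ (a , b , move))
pokes⇒outcome {R} {A} {B} {M} {C} {a} {b} a∈A M≈ (_◅_ {j = M′} poke pokes) C≈ red B-pokable
  with poke-step {R} {A} {M} {M′} a∈A M≈ poke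
... | inj₁ (c , c∈A , M′≈) = pokes⇒outcome {R} {A} {B} {M′} {C} c∈A M′≈ pokes C≈ red B-pokable
... | inj₂ (p , c , A₁ , move , c∈A₁ , pc , M′≈) = inj₂ (inj₂
  (a , p , A₁ , move , c , b , c∈A₁ , pc , red
  , pokesTo-cong {R} {M′} {B without b} {A₁ without c} {B without b} M′≈ (id , id)
    ( ( pokes-pokable pokes
          (pokable-cong {R} {B without b} {C} (≈-sym {C} {B without b} C≈) B-pokable)
      , B-pokable)
    , C , pokes , C≈)))

viaPokes⇒moves : ∀ {R A B} → ViaPokes R A B → A ⟶* B
viaPokes⇒moves {R} {A} {B} (c₁ , p₁ , A₁ , move , a , b , a∈A₁ , _ , red , _ , C , pokes , C≈) =
  let D , moves , D≈B = pokes⇒moves {R} {A₁} {B} {A₁ without a} {C} a∈A₁ (id , id) pokes C≈ red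
  in D , (c₁ , p₁ , move) ◅ moves , D≈B

other : ∀ {S p} → p ∈ TwoNeighboursIn S → ∀ c → ∃ λ q → q ∈ S × q ≢ c × Neighbour p q
other (q , r , q≢r , pq , pr , q∈S , r∈S) c with q ≟ c
... | no  q≢c  = q , q∈S , q≢c , pq
... | yes refl = r , r∈S , q≢r ∘ sym , pr

-- The coin just placed has two neighbours, so the target of a last move can serve as the redundant
-- coin `b`.
move-redundant : ∀ {A c p B} → Move A c p B →
  Redundant B p × A without c ≈ B without p
move-redundant {A} {c} {p} {B} (_ , p∉A , two , B⊆ , B⊇) =
  (B⊇ (inj₂ refl) , twoNeighbours-mono (λ q∈ → B⊇ (inj₁ q∈)) two) , to , from
  where
  to : ⟦ A without c ⟧ ⊆ ⟦ B without p ⟧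
  to q∈ with ∈-without⁻ A q∈
  ... | q∈A , c≢q = ∈-without⁺ B (B⊇ (inj₁ (q∈A , c≢q))) λ { refl → p∉A q∈A }
  from : ⟦ B without p ⟧ ⊆ ⟦ A without c ⟧
  from q∈ with ∈-without⁻ B q∈
  ... | q∈B , p≢q with B⊆ q∈B
  ... | inj₁ (q∈A , c≢q) = ∈-without⁺ A q∈A c≢q
  ... | inj₂ p≡q         = contradiction p≡q p≢q

-- Normal form of a sequence of moves

module Game (R : Rectangle) (R-odd : Odd R) (M₀ : Configuration) (M₀-min : Minimum M₀)
  (M₀-span : HasSpan M₀ R) where

  -- The invariant along a sequence of moves. It bounds the size instead of naming a surplus coin,
  -- because the next move decides which coin counts as surplus.
  AtMost+1 : Pred Configuration 0ℓ
  AtMost+1 A = HasSpan A R × ∣ A ∣ ≤ suc ∣ M₀ ∣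

  module _ {A c p B} (A+1 : AtMost+1 A) (move : Move A c p B) (R⊆B : points R ⊆ span B) where

    move-+1 : AtMost+1 B
    move-+1 =
      ( (λ q∈ → proj₁ (proj₁ A+1) (without-span A c (move-span {A} {c} {p} {B} move q∈)))
      , (λ q∈ → R⊆B q∈))
      , ℕ.≤-trans (move-size {A} {c} {p} {B} move) (proj₂ A+1)

    -- Any coin that is about to move is a surplus coin: by `move-span` the others still span `R`,
    -- and there are at most `∣ M₀ ∣` of them.
    move-without : Minimum (A without c) × HasSpan (A without c) R
    move-without = few⇒minimum {R} {M₀} M₀-min M₀-span (A without c) A∖c-span few , A∖c-span
      where
      A∖c-span : HasSpan (A without c) R
      A∖c-span = (λ q∈ → proj₁ (proj₁ A+1) (without-span A c q∈))
        , (λ q∈ → move-span {A} {c} {p} {B} move (R⊆B q∈))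
      few : ∣ A without c ∣ ≤ ∣ M₀ ∣
      few = ℕ.s≤s⁻¹ (ℕ.≤-trans (size-without A (proj₁ move)) (proj₂ A+1))

  data Joined (A : Configuration) (p₁ : Position) (A₁ : Configuration) (c₂ p₂ : Position)
    (A₂ : Configuration) : Set where
    undone : A ≈ A₂ → Joined A p₁ A₁ c₂ p₂ A₂
    merged : ∀ {c₁} → Move A c₁ p₂ A₂ → Joined A p₁ A₁ c₂ p₂ A₂
    linked : Neighbour p₁ c₂ → Pokable R (A₁ without c₂) → Joined A p₁ A₁ c₂ p₂ A₂

  -- Either the same coin moves twice, or the second coin leaves p₁ with a single neighbour: otherwise
  -- p₁ and two of its neighbours would remain in A₁ ∖ {c₂}, which is minimum.
  join : ∀ {A c₁ p₁ A₁ c₂ p₂ A₂} → AtMost+1 A → Move A c₁ p₁ A₁ → Move A₁ c₂ p₂ A₂ →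
    points R ⊆ span A₂ → Joined A p₁ A₁ c₂ p₂ A₂
  join {A} {c₁} {p₁} {A₁} {c₂} {p₂} {A₂} A+1 m₁@(c₁∈A , p₁∉A , two₁@(q , r , q≢r , p₁q , p₁r , (q∈A , c₁≢q) , (r∈A , c₁≢r)) , A₁⊆ , A₁⊇)
    m₂@(c₂∈A₁ , p₂∉A₁ , two₂ , A₂⊆ , A₂⊇) R⊆A₂ = byCases (c₂ ≟ p₁)
    where
    R⊆A₁ : points R ⊆ span A₁
    R⊆A₁ x∈ = without-span A₁ c₂ (move-span {A₁} {c₂} {p₂} {A₂} m₂ (R⊆A₂ x∈))
    A₁+1 : AtMost+1 A₁
    A₁+1 = move-+1 {A} {c₁} {p₁} {A₁} A+1 m₁ R⊆A₁
    N = A₁ without c₂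
    N-minimum : Minimum N × HasSpan N R
    N-minimum = move-without {A₁} {c₂} {p₂} {A₂} A₁+1 m₂ R⊆A₂
    byCases : Dec (c₂ ≡ p₁) → Joined A p₁ A₁ c₂ p₂ A₂
    -- A return to `c₁` restores `A` and is no single move, because the target of a move must be
    -- free.
    byCases (yes refl) = same-coin (p₂ ≟ c₁)
      where
      A₁∖p₁⊆ : (⟦ A₁ ⟧ ∖ ｛ p₁ ｝) ⊆ (⟦ A ⟧ ∖ ｛ c₁ ｝)
      A₁∖p₁⊆ (x∈A₁ , p₁≢x) with A₁⊆ x∈A₁
      ... | inj₁ x∈    = x∈
      ... | inj₂ p₁≡x  = contradiction p₁≡x p₁≢x
      A₁∖p₁⊇ : (⟦ A ⟧ ∖ ｛ c₁ ｝) ⊆ (⟦ A₁ ⟧ ∖ ｛ p₁ ｝)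
      A₁∖p₁⊇ x∈@(x∈A , _) = A₁⊇ (inj₁ x∈) , λ { refl → p₁∉A x∈A }
      to : ⟦ A₂ ⟧ ⊆ Moved A c₁ p₂
      to x∈ with A₂⊆ x∈
      ... | inj₁ x∈′  = inj₁ (A₁∖p₁⊆ x∈′)
      ... | inj₂ p₂≡x = inj₂ p₂≡x
      from : Moved A c₁ p₂ ⊆ ⟦ A₂ ⟧
      from (inj₁ x∈)   = A₂⊇ (inj₁ (A₁∖p₁⊇ x∈))
      from (inj₂ p₂≡x) = A₂⊇ (inj₂ p₂≡x)
      same-coin : Dec (p₂ ≡ c₁) → Joined A p₁ A₁ p₁ p₂ A₂
      same-coin (yes refl) = undone (A⊆A₂ , A₂⊆A)
        where
        A⊆A₂ : ⟦ A ⟧ ⊆ ⟦ A₂ ⟧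
        A⊆A₂ {x} x∈A with c₁ ≟ x
        ... | yes c₁≡x = from (inj₂ c₁≡x)
        ... | no  c₁≢x = from (inj₁ (x∈A , c₁≢x))
        A₂⊆A : ⟦ A₂ ⟧ ⊆ ⟦ A ⟧
        A₂⊆A x∈ with to x∈
        ... | inj₁ (x∈A , _) = x∈A
        ... | inj₂ refl      = c₁∈A
      same-coin (no p₂≢c₁) = merged
        ( c₁∈A
        , (λ p₂∈A → p₂∉A₁ (proj₁ (A₁∖p₁⊇ (p₂∈A , λ c₁≡p₂ → p₂≢c₁ (sym c₁≡p₂)))))
        , twoNeighbours-mono A₁∖p₁⊆ two₂
        , to , from)
    byCases (no c₂≢p₁) = linkedBy (q ≟ c₂) (r ≟ c₂)
      where
      N-⊇ : (⟦ A ⟧ ∖ ｛ c₁ ｝) ⊆ λ x → x ≢ c₂ → x ∈ ⟦ N ⟧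
      N-⊇ x∈ x≢c₂ = ∈-without⁺ A₁ (A₁⊇ (inj₁ x∈)) λ c₂≡x → x≢c₂ (sym c₂≡x)
      p₁∈N : p₁ ∈ ⟦ N ⟧
      p₁∈N = ∈-without⁺ A₁ (A₁⊇ (inj₂ refl)) c₂≢p₁
      -- The neighbour of `p₁` that stays forms with `p₁` the adjacent pair required of a position
      -- of the game.
      N-pokable : ∀ {x} → x ∈ ⟦ N ⟧ → Neighbour p₁ x → Pokable R N
      N-pokable x∈N p₁x = proj₁ N-minimum , proj₂ N-minimum , p₁ , _ , p₁∈N , x∈N , p₁x
      linkedBy : Dec (q ≡ c₂) → Dec (r ≡ c₂) → Joined A p₁ A₁ c₂ p₂ A₂
      linkedBy (yes refl) _ =
        linked p₁q (N-pokable (N-⊇ (r∈A , c₁≢r) (λ r≡q → q≢r (sym r≡q))) p₁r)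
      linkedBy (no q≢c₂) (yes refl) = linked p₁r (N-pokable (N-⊇ (q∈A , c₁≢q) q≢c₂) p₁q)
      linkedBy (no q≢c₂) (no r≢c₂)
        with oneAdjacentPair R R-odd N (proj₁ N-minimum) (proj₂ N-minimum)
          p₁∈N (N-⊇ (q∈A , c₁≢q) q≢c₂) p₁q p₁∈N (N-⊇ (r∈A , c₁≢r) r≢c₂) p₁r
      ... | inj₁ (_ , r≡q)  = contradiction (sym r≡q) q≢r
      ... | inj₂ (p₁≡q , _) = contradiction p₁≡q (neighbour-irrefl p₁q)

  -- After the removal of a, the coin p still has a neighbour; A′ ∖ {a} has only one adjacent pair, so
  -- a must belong to the adjacent pair of A ∖ {c}.
  step-is-poke : ∀ {A c p A′ a} → Pokable R (A without c) → Move A c p A′ →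
    a ∈ ⟦ A′ ⟧ → Neighbour p a → Pokable R (A′ without a) → Poke R (A without c) (A′ without a)
  step-is-poke {A} {c} {p} {A′} {a} M-pokable@(_ , _ , x , y , x∈M , y∈M , xy)
    (_ , p∉A , two , A′⊆ , A′⊇) a∈A′ pa (M′-min , M′-span , _) =
    M-pokable , a , proj₁ partner , a∈M , proj₁ (proj₂ partner) , proj₂ (proj₂ partner)
    , p , neighbour-sym pa , p∉M , (q , ∈-without⁺ A (proj₁ q∈) (proj₂ q∈) , q≢a , pq) , to , from
    where
    M = A without c
    M′ = A′ without a
    p≢a : p ≢ a
    p≢a = neighbour-irrefl pa
    p∉M : p ∉ ⟦ M ⟧
    p∉M p∈M = p∉A (proj₁ (∈-without⁻ A p∈M))
    a∈M : a ∈ ⟦ M ⟧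
    a∈M with A′⊆ a∈A′
    ... | inj₁ (a∈A , c≢a) = ∈-without⁺ A a∈A c≢a
    ... | inj₂ p≡a         = contradiction p≡a p≢a
    q = proj₁ (other two a)
    q∈ = proj₁ (proj₂ (other two a))
    q≢a = proj₁ (proj₂ (proj₂ (other two a)))
    pq = proj₂ (proj₂ (proj₂ (other two a)))
    to : ⟦ M′ ⟧ ⊆ Moved M a p
    to z∈M′ with ∈-without⁻ A′ z∈M′
    ... | z∈A′ , a≢z with A′⊆ z∈A′
    ... | inj₁ (z∈A , c≢z) = inj₁ (∈-without⁺ A z∈A c≢z , a≢z)
    ... | inj₂ p≡z         = inj₂ p≡z
    from : Moved M a p ⊆ ⟦ M′ ⟧
    from (inj₁ (z∈M , a≢z)) = ∈-without⁺ A′ (A′⊇ (inj₁ (∈-without⁻ A z∈M))) a≢z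
    from (inj₂ refl)        = ∈-without⁺ A′ (A′⊇ (inj₂ refl)) (p≢a ∘ sym)
    partner : ∃ λ c′ → c′ ∈ ⟦ M ⟧ × Neighbour a c′
    partner with a ≟ x | a ≟ y
    ... | yes refl | _        = y , y∈M , xy
    ... | no _     | yes refl = x , x∈M , neighbour-sym xy
    ... | no a≢x   | no a≢y
      with oneAdjacentPair R R-odd M′ M′-min M′-span
        (from (inj₁ (x∈M , a≢x))) (from (inj₁ (y∈M , a≢y))) xy
        (from (inj₂ refl)) (from (inj₁ (∈-without⁺ A (proj₁ q∈) (proj₂ q∈) , q≢a ∘ sym))) pq
    ... | inj₁ (refl , _) = contradiction x∈M p∉M
    ... | inj₂ (refl , _) = contradiction y∈M p∉M

  prepend : ∀ {A c p A′ B} → AtMost+1 A → Move A c p A′ → points R ⊆ span B →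
    Outcome R A′ B → Outcome R A B
  prepend {A} {c} {p} {A′} {B} A+1 (c∈A , p∉A , two , A′≐) R⊆B (inj₁ A′≈B) =
    inj₂ (inj₁ (c , p , c∈A , p∉A , two , ≈-moved {A} {c} {p} {A′} {B} A′≈B A′≐))
  prepend {A} {c} {p} {A′} {B} A+1 move R⊆B (inj₂ (inj₁ (c₂ , p₂ , move₂)))
    with join {A} {c} {p} {A′} {c₂} {p₂} {B} A+1 move move₂ R⊆B
  ... | undone A≈B          = inj₁ A≈B
  ... | merged {c₁} move′   = inj₂ (inj₁ (c₁ , p₂ , move′))
  -- The second move only carries the surplus coin `c₂` to `b = p₂`, so the sequence of pokes is
  -- empty.
  ... | linked pc₂ N-pokable =
    let red , N≈ = move-redundant {A′} {c₂} {p₂} {B} move₂ in inj₂ (inj₂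
    ( c , p , A′ , move , c₂ , p₂ , proj₁ move₂ , pc₂ , red
    , (N-pokable , pokable-cong {R} {A′ without c₂} {B without p₂} N≈ N-pokable)
    , A′ without c₂ , ε , N≈))
  prepend {A} {c} {p} {A′} {B} A+1 move R⊆B
    (inj₂ (inj₂ (c₂ , p₂ , A₂ , move₂ , a , b , a∈A₂ , p₂a , red , pokesTo@((M-pokable , B-pokable) , C , pokes , C≈))))
    with join {A} {c} {p} {A′} {c₂} {p₂} {A₂} A+1 move move₂
      (λ x∈ → without-span A₂ a (proj₂ (proj₁ (proj₂ M-pokable)) x∈))
  -- The opening move is lost; the surplus coin `a` already lies in `A`, and the pokes are replayed
  -- from there.
  ... | undone A≈A₂         = pokes⇒outcome {R} {A} {B} {A₂ without a} {C}
    (proj₂ A≈A₂ a∈A₂) (without-cong {A₂} {A} a (≈-sym {A} {A₂} A≈A₂)) pokes C≈ red B-pokable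
  ... | merged {c₁} move′   = inj₂ (inj₂
    (c₁ , p₂ , A₂ , move′ , a , b , a∈A₂ , p₂a , red , pokesTo))
  -- The former opening move turns into the first poke, and the game now starts from
  -- `A′ without c₂`.
  ... | linked pc₂ N-pokable = inj₂ (inj₂
    ( c , p , A′ , move , c₂ , b , proj₁ move₂ , pc₂ , red
    , (N-pokable , B-pokable) , C
    , step-is-poke {A′} {c₂} {p₂} {A₂} {a} N-pokable move₂ a∈A₂ p₂a M-pokable ◅ pokes , C≈))

  moves⇒outcome : ∀ {A C B} → AtMost+1 A → Star _⟶_ A C → C ≈ B → points R ⊆ span B → Outcome R A B
  moves⇒outcome A+1 ε C≈B R⊆B = inj₁ C≈B
  moves⇒outcome {A} {C} {B} A+1 (_◅_ {j = A′} (c , p , move) moves) C≈B R⊆B =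
    prepend {A} {c} {p} {A′} {B} A+1 move R⊆B
      (moves⇒outcome {A′} {C} {B} (move-+1 {A} {c} {p} {A′} A+1 move R⊆A′) moves C≈B R⊆B)
    where
    R⊆A′ : points R ⊆ span A′
    -- Spans never grow along moves, so what `B` spans was spanned at every earlier point.
    R⊆A′ x∈ = moves-span moves (proj₂ (span-cong {C} {B} C≈B) (R⊆B x∈))

-- Decision procedures

length-cartesianProduct : ∀ {A B : Set} (xs : List A) (ys : List B) →
  length (cartesianProduct xs ys) ≡ length xs * length ys
length-cartesianProduct []       ys = refl
length-cartesianProduct (x ∷ xs) ys = trans (length-++ (map (x ,_) ys))
  (cong₂ _+_ (length-map (x ,_) ys) (length-cartesianProduct xs ys))

any-dec : ∀ {A : Set} {P : Pred A 0ℓ} {xs} → All (λ x → Dec (P x)) xs → Dec (Any P xs)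
any-dec []         = no λ ()
any-dec (P? ∷ all) = map′ [ here , there ]′ (λ { (here p) → inj₁ p ; (there any) → inj₂ any })
  (P? ⊎-dec any-dec all)

_≈?_ : ∀ C D → Dec (C ≈ D)
C ≈? D = map′
  (λ (C⊆D , D⊆C) → (λ p∈ → All.lookup C⊆D p∈) , (λ p∈ → All.lookup D⊆C p∈))
  (λ (C⊆D , D⊆C) → All.tabulate (λ p∈ → C⊆D p∈) , All.tabulate (λ p∈ → D⊆C p∈))
  (all? (_∈? coins D) (coins C) ×-dec all? (_∈? coins C) (coins D))

twoNeighbours∖? : ∀ A c → Decidable (TwoNeighboursIn (⟦ A ⟧ ∖ ｛ c ｝))
twoNeighbours∖? A c = twoNeighbours? λ q → q ∈? coins A ×-dec ¬? (c ≟ q)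

move? : ∀ A c p B → Dec (Move A c p B)
move? A c p B = c ∈? coins A ×-dec ¬? (p ∈? coins A) ×-dec twoNeighbours∖? A c p
  ×-dec map′ (λ B≈ → ≈-moved {A} {c} {p} {A [ c ↦ p ]} {B} (≈-sym {B} {A [ c ↦ p ]} B≈) (moved A c p))
    (moved-≈ {A} {c} {p} {B}) (B ≈? (A [ c ↦ p ]))

-- The target of the move is a coin of `B`, so the search is finite.
_⟶?_ : ∀ A B → Dec (A ⟶ B)
A ⟶? B = map′ to from (any? (λ c → any? (λ p → move? A c p B) (coins B)) (coins A))
  where
  to : Any (λ c → Any (λ p → Move A c p B) (coins B)) (coins A) → A ⟶ B
  to any = let c , _ , any′ = find any ; p , _ , move = find any′ in c , p , move
  from : A ⟶ B → Any (λ c → Any (λ p → Move A c p B) (coins B)) (coins A)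
  from (c , p , move@(c∈A , _ , _ , _ , B⊇)) = lose c∈A (lose (B⊇ (inj₂ refl)) move)

redundant? : ∀ B b → Dec (Redundant B b)
redundant? B b = b ∈? coins B ×-dec twoNeighbours? (_∈? coins B) b

-- Enumeration of the queries

module Queries (R : Rectangle) (M₀ : Configuration) (M₀-min : Minimum M₀) (M₀-span : HasSpan M₀ R)
  (A B : Configuration) where

  -- Minimality quantifies over all configurations, but once the span is `R` it amounts to a
  -- comparison of sizes with the known minimum `M₀`.
  minimum? : ∀ M → HasSpan M R → Dec (Minimum M)
  minimum? M M-span = map′
    (few⇒minimum {R} {M₀} M₀-min M₀-span M M-span)
    (λ M-min → M-min M₀ (sameSpan {R} {M₀} {M} M₀-span M-span))
    (∣ M ∣ ℕ.≤? ∣ M₀ ∣)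

  pokable? : ∀ M → Dec (Pokable R M)
  pokable? M with hasSpan? R M
  ... | no ¬span = no λ (_ , M-span , _) → ¬span M-span
  ... | yes M-span = map′ (λ (M-min , pair) → M-min , M-span , pair) (λ (M-min , _ , pair) → M-min , pair)
    (minimum? M M-span ×-dec map′ to from
      (any? (λ c → any? (λ c′ → c′ ∈? neighbours c) (coins M)) (coins M)))
    where
    to : Any (λ c → Any (Neighbour c) (coins M)) (coins M) →
      ∃₂ λ c c′ → c ∈ ⟦ M ⟧ × c′ ∈ ⟦ M ⟧ × Neighbour c c′
    to any = let c , c∈ , any′ = find any ; c′ , c′∈ , cc′ = find any′ in c , c′ , c∈ , c′∈ , cc′
    from : (∃₂ λ c c′ → c ∈ ⟦ M ⟧ × c′ ∈ ⟦ M ⟧ × Neighbour c c′) →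
      Any (λ c → Any (Neighbour c) (coins M)) (coins M)
    from (c , c′ , c∈ , c′∈ , cc′) = lose c∈ (lose c′∈ cc′)

  Choice : Set
  Choice = Position × (Position × Position) × Position

  instanceOf : Choice → Configuration × Configuration
  instanceOf (c , (p , a) , b) = A [ c ↦ p ] without a , B without b

  Valid : Pred Choice 0ℓ
  Valid (c , (p , a) , b) = Move A c p (A [ c ↦ p ]) × a ∈ ⟦ A [ c ↦ p ] ⟧ × Neighbour p a
    × Redundant B b × PokingInstance R (instanceOf (c , (p , a) , b))

  valid? : Decidable Valid
  valid? (c , (p , a) , b) = move? A c p (A [ c ↦ p ]) ×-dec a ∈? coins (A [ c ↦ p ])
    ×-dec a ∈? neighbours p ×-dec redundant? B b
    ×-dec (pokable? (A [ c ↦ p ] without a) ×-dec pokable? (B without b))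

  -- A target p₁ of a move is the end of an edge starting in A, and a redundant coin of B is the start
  -- of an inner edge of B.
  choices : List Choice
  choices = cartesianProduct (coins A)
    (cartesianProduct (edges (map proj₂ (edges (coins A)))) (map proj₁ (inner B)))

  allQueries : List (Configuration × Configuration)
  allQueries = map instanceOf (filter valid? choices)

  length-allQueries : length allQueries ≤ 16 * ∣ A ∣ ^ 2 * length (inner B)
  length-allQueries = begin
    length allQueries               ≡⟨ length-map instanceOf (filter valid? choices) ⟩
    length (filter valid? choices)  ≤⟨ length-filter valid? choices ⟩
    length choices                  ≡⟨ length-cartesianProduct (coins A) _ ⟩
    N * length (cartesianProduct (edges (map proj₂ (edges (coins A)))) (map proj₁ (inner B)))
      ≡⟨ cong (N *_) (length-cartesianProduct (edges (map proj₂ (edges (coins A)))) _) ⟩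
    N * (length (edges (map proj₂ (edges (coins A)))) * length (map proj₁ (inner B)))
      ≡⟨ cong₂ (λ m n → N * (m * n)) length-moves (length-map proj₁ (inner B)) ⟩
    N * (4 * (4 * N) * I)           ≡⟨ solve 2 (λ n i → n :* (con 4 :* (con 4 :* n) :* i) := con 16 :* (n :* (n :* con 1)) :* i) refl N I ⟩
    16 * N ^ 2 * I                  ∎
    where
    open ℕ.≤-Reasoning
    open +-*-Solver
    N = ∣ A ∣
    I = length (inner B)
    length-moves : length (edges (map proj₂ (edges (coins A)))) ≡ 4 * (4 * N)
    length-moves = trans (length-edges (map proj₂ (edges (coins A))))
      (cong (4 *_) (trans (length-map proj₂ (edges (coins A))) (length-edges (coins A))))

  sound : All (Query R A B) allQueries
  sound = All.tabulate λ X∈ → query (∈-map∘filter⁻ instanceOf valid? {xs = choices} X∈)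
    where
    query : ∀ {X} → (∃ λ t → t ∈ˡ choices × X ≡ instanceOf t × Valid t) → Query R A B X
    query ((c , (p , a) , b) , _ , refl , move , a∈ , pa , red , pokable) =
      pokable , c , p , A [ c ↦ p ] , move , a , b , a∈ , pa , red , (id , id) , (id , id)

  complete : ∀ M M′ → Query R A B (M , M′) → Any (λ (X , X′) → X ≈ M × X′ ≈ M′) allQueries
  complete M M′ ((M-pokable , M′-pokable) , c , p , A₁ ,
    (c∈A , p∉A , two@(q , _ , _ , pq , _ , (q∈A , _) , _) , A₁≐) , a , b , a∈A₁ , pa ,
    red@(b∈B , r , _ , _ , br , _ , r∈B , _) , M≈ , M′≈) =
    lose (∈-map∘filter⁺ instanceOf valid? (t , t∈ , refl , valid))
      (≈-sym {M} {proj₁ (instanceOf t)} M≈′ , ≈-sym {M′} {B without b} M′≈)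
    where
    t : Choice
    t = c , (p , a) , b
    A₁≈ : A₁ ≈ A [ c ↦ p ]
    A₁≈ = moved-≈ {A} {c} {p} {A₁} A₁≐
    M≈′ : M ≈ A [ c ↦ p ] without a
    M≈′ = ≈-trans {M} {A₁ without a} {A [ c ↦ p ] without a} M≈
      (without-cong {A₁} {A [ c ↦ p ]} a A₁≈)
    valid : Valid t
    valid = (c∈A , p∉A , two , moved A c p) , proj₁ A₁≈ a∈A₁ , pa , red
      , pokable-cong {R} {M} {A [ c ↦ p ] without a} M≈′ M-pokable
      , pokable-cong {R} {M′} {B without b} M′≈ M′-pokable
    t∈ : t ∈ˡ choices
    t∈ = ∈-cartesianProduct⁺ c∈A (∈-cartesianProduct⁺
      (∈-edges⁺ (∈-map⁺ proj₂ (∈-edges⁺ q∈A (neighbour-sym pq))) pa)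
      (∈-map⁺ proj₁ (∈-inner⁺ B b∈B r∈B br)))

-- Sizes and the reduction

minimum+1-size : ∀ {A} (A+1 : Minimum+1 A) → ∣ A ∣ ≡ suc ∣ proj₁ A+1 ∣
minimum+1-size {A} (M , a , _ , _ , a∉M , A⊆ , A⊇) =
  ℕ.≤-antisym (size-mono A (insert M a∉M) to) (size-mono (insert M a∉M) A from)
  where
  to : ⟦ A ⟧ ⊆ ⟦ insert M a∉M ⟧
  to q∈ with A⊆ q∈
  ... | inj₁ q∈M  = there q∈M
  ... | inj₂ refl = here refl
  from : ⟦ insert M a∉M ⟧ ⊆ ⟦ A ⟧
  from (here refl) = A⊇ (inj₂ refl)
  from (there q∈M) = A⊇ (inj₁ q∈M)

minimum-size : ∀ {R M M′} → Minimum M → HasSpan M R → Minimum M′ → HasSpan M′ R → ∣ M ∣ ≡ ∣ M′ ∣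
minimum-size {R} {M} {M′} M-min M-span M′-min M′-span = ℕ.≤-antisym
  (M-min M′ (sameSpan {R} {M′} {M} M′-span M-span)) (M′-min M (sameSpan {R} {M} {M′} M-span M′-span))

module Reduction (R : Rectangle) (R-odd : Odd R) (A B : Configuration)
  (A+1 : Minimum+1 A) (A-span : HasSpan A R) (B+1 : Minimum+1 B) (B-span : HasSpan B R) where

  M₀ : Configuration
  M₀ = proj₁ A+1

  coreSpan : ∀ {C} → HasSpan C R → (C+1 : Minimum+1 C) → HasSpan (proj₁ C+1) R
  coreSpan C-span (_ , _ , _ , span≐ , _) =
    (λ p∈ → proj₁ C-span (proj₁ span≐ p∈)) , (λ p∈ → proj₂ span≐ (proj₂ C-span p∈))

  M₀-min : Minimum M₀
  M₀-min = proj₁ (proj₂ (proj₂ A+1))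

  M₀-span : HasSpan M₀ R
  M₀-span = coreSpan {A} A-span A+1

  sameSize : ∣ A ∣ ≡ ∣ B ∣
  sameSize = trans (minimum+1-size {A} A+1) (trans
    (cong suc (minimum-size {R} {M₀} {proj₁ B+1} M₀-min M₀-span
      (proj₁ (proj₂ (proj₂ B+1))) (coreSpan {B} B-span B+1)))
    (sym (minimum+1-size {B} B+1)))

  open Game R R-odd M₀ M₀-min M₀-span
  open Queries R M₀ M₀-min M₀-span A B

  outcome : A ⟶* B → Outcome R A B
  outcome (C , moves , C≈B) = moves⇒outcome {A} {C} {B}
    (A-span , ℕ.≤-reflexive (minimum+1-size {A} A+1)) moves C≈B (λ p∈ → proj₂ B-span p∈)

  -- The L-shaped configuration bounds `4 * ∣ M₀ ∣` by `2 * n + 4`, the surplus coin adds four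
  -- edges, and the perimeter takes away `2 * n`. So the number of redundant coins of `B` is bounded
  -- independently of its size.
  inner-few : length (inner B) ≤ 8
  inner-few = ℕ.+-cancelˡ-≤ (2 * n) _ _ (begin
    2 * n + length (inner B)   ≤⟨ perimeter R R-inhabited B B-span ⟩
    4 * ∣ B ∣                  ≡⟨ cong (4 *_) (trans (sym sameSize) (minimum+1-size {A} A+1)) ⟩
    4 * suc ∣ M₀ ∣             ≡⟨ ℕ.*-suc 4 ∣ M₀ ∣ ⟩
    4 + 4 * ∣ M₀ ∣             ≡⟨ cong (4 +_) (ℕ.*-assoc 2 2 ∣ M₀ ∣) ⟩
    4 + 2 * (2 * ∣ M₀ ∣)       ≤⟨ ℕ.+-monoʳ-≤ 4 (ℕ.*-monoʳ-≤ 2 (minimum-few R R-inhabited M₀ M₀-min M₀-span)) ⟩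
    4 + 2 * (2 + n)            ≡⟨ solve 1 (λ m → con 4 :+ con 2 :* (con 2 :+ m) := con 2 :* m :+ con 8) refl n ⟩
    2 * n + 8                  ∎)
    where
    open ℕ.≤-Reasoning
    open +-*-Solver
    n = width R + height R
    B-coin = proj₁ (proj₂ B+1)
    R-inhabited : Inhabited R
    R-inhabited = inhabited R
      (proj₁ B-span (coins⊆span B {B-coin} (proj₂ (proj₂ (proj₂ (proj₂ (proj₂ (proj₂ B+1))))) (inj₂ refl))))

  fewQueries : length allQueries ≤ 128 * ∣ A ∣ ^ 2
  fewQueries = begin
    length allQueries                      ≤⟨ length-allQueries ⟩
    16 * ∣ A ∣ ^ 2 * length (inner B)      ≤⟨ ℕ.*-monoʳ-≤ (16 * ∣ A ∣ ^ 2) inner-few ⟩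
    16 * ∣ A ∣ ^ 2 * 8                     ≡⟨ solve 1 (λ m → con 16 :* m :* con 8 := con 128 :* m) refl (∣ A ∣ ^ 2) ⟩
    128 * ∣ A ∣ ^ 2                        ∎
    where
    open ℕ.≤-Reasoning
    open +-*-Solver

  outcome⇒answers : Outcome R A B → A ≈ B ⊎ A ⟶ B ⊎ Any (PokesTo R) allQueries
  outcome⇒answers (inj₁ A≈B)       = inj₁ A≈B
  outcome⇒answers (inj₂ (inj₁ A⟶B)) = inj₂ (inj₁ A⟶B)
  outcome⇒answers (inj₂ (inj₂ (c , p , A₁ , move , a , b , a∈ , pa , red , pokesTo))) =
    let X , X∈ , X≈ , X′≈ = find (complete (A₁ without a) (B without b)
          (proj₁ pokesTo , c , p , A₁ , move , a , b , a∈ , pa , red , (id , id) , (id , id)))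
    in inj₂ (inj₂ (lose X∈ (pokesTo-cong {R} {A₁ without a} {B without b} {proj₁ X} {proj₂ X}
      (≈-sym {proj₁ X} {A₁ without a} X≈) (≈-sym {proj₂ X} {B without b} X′≈) pokesTo)))

  answers⇒moves : A ≈ B ⊎ A ⟶ B ⊎ Any (PokesTo R) allQueries → A ⟶* B
  answers⇒moves (inj₁ A≈B)        = A , ε , A≈B
  answers⇒moves (inj₂ (inj₁ A⟶B)) = B , A⟶B ◅ ε , id , id
  answers⇒moves (inj₂ (inj₂ some)) with find some
  ... | (M , M′) , X∈ , pokesTo with All.lookup sound X∈
  ... | _ , c , p , A₁ , move , a , b , a∈ , pa , red , M≈ , M′≈ = viaPokes⇒moves {R} {A} {B}
    ( c , p , A₁ , move , a , b , a∈ , pa , red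
    , pokesTo-cong {R} {M} {M′} {A₁ without a} {B without b} M≈ M′≈ pokesTo)

  correctness : (A ⟶* B) ⇔ (A ≈ B ⊎ A ⟶ B ⊎ Any (PokesTo R) allQueries)
  correctness = mk⇔ (λ moves → outcome⇒answers (outcome moves)) answers⇒moves

  reduction : ReducesToPoking R A B (128 * ∣ A ∣ ^ 2)
  reduction = record
    { queries    = allQueries
    ; enumerates = sound , complete
    ; few        = fewQueries
    ; correct    = correctness
    -- The two alternatives outside the game are settled by finite search, so only the queries call
    -- for answers.
    ; decides    = λ answers → map′ answers⇒moves (λ moves → outcome⇒answers (outcome moves))
        ((A ≈? B) ⊎-dec (A ⟶? B) ⊎-dec any-dec answers)
    }

  characterisation : ¬ (A ≈ B) → ¬ (A ⟶ B) → (A ⟶* B) ⇔ ViaPokes R A B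
  characterisation A≉B ¬A⟶B = mk⇔ (λ moves → only (outcome moves)) (viaPokes⇒moves {R} {A} {B})
    where
    only : Outcome R A B → ViaPokes R A B
    only (inj₁ A≈B)        = contradiction A≈B A≉B
    only (inj₂ (inj₁ A⟶B)) = contradiction A⟶B ¬A⟶B
    only (inj₂ (inj₂ via)) = via

proposition5p7 : ((R : Rectangle) → Odd R → (A B : Configuration) →
    Minimum+1 A → HasSpan A R → Minimum+1 B → HasSpan B R →
    ¬ (A ≈ B) → ¬ (A ⟶ B) →
    (A ⟶* B) ⇔
    (∃₂ λ c₁ p₁ → ∃ λ A₁ → Move A c₁ p₁ A₁
    × (∃₂ λ a b → a ∈ ⟦ A₁ ⟧ × Neighbour p₁ a × Redundant B b
    × PokesTo R (A₁ without a , B without b))))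
    ×
    (∃ λ (K : ℕ) → (R : Rectangle) → Odd R → (A B : Configuration) →
    Minimum+1 A → HasSpan A R → Minimum+1 B → HasSpan B R →
    ∣ A ∣ ≡ ∣ B ∣ × ReducesToPoking R A B (K * ∣ A ∣ ^ 2))
proposition5p7 =
    Reduction.characterisation
  , 128 , λ R R-odd A B A+1 A-span B+1 B-span →
      Reduction.sameSize R R-odd A B A+1 A-span B+1 B-span , Reduction.reduction R R-odd A B A+1 A-span B+1 B-span
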